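{- Let $M\ge1$ be an integer and set $$e_j^{[M]}(t):=e_j(1,t,\ldots,t^{M-1})=t^{\binom j2}\begin{bmatrix} M \\ j \end{bmatrix}_t,\qquad 0\le j\le M.$$ Then for every $m\ge0$ the coefficients $f_m^{[M]}(t)$ satisfy $$\sum_{j=0}^{\min(M,m)}e_j^{[M]}(t)\,f_{m-j}^{[M]}(t)=\begin{cases}(-1)^m e_m^{[M]}(t),&0\le m\le M,\\ 0,&m>M.\end{cases}$$ In particular, for $m>M$, $$f_m^{[M]}(t)=-\sum_{j=1}^{M}e_j^{[M]}(t)\,f_{m-j}^{[M]}(t).$$
   Context: Let $t$ be an indeterminate. The coefficients $f_m^{[M]}(t)$ are defined by $F_{t,t^M}(u)=\sum_{m\ge0}f_m^{[M]}(t)u^m$, where $$F_{t,s}(u)=\exp\Big(-2\sum_{n\ge1,\ n\text{ odd}}\frac{1-s^n}{1-t^n}\frac{u^n}{n}\Big)$$ as a formal power series in $u$. Here $e_j$ is the $j$th elementary symmetric polynomial and $\begin{bmatrix} n \\ k \end{bmatrix}_t$ is the Gaussian binomial coefficient in $t$. -}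

module Defs where

open import Algebra.Bundles using (CommutativeRing)
open import Data.Fin.Base as Fin using (toℕ)
import Data.Fin.Properties as Fin
open import Data.Integer.Base as ℤ using (+_; -[1+_])
open import Data.List.Base as List using (List; []; _∷_; _++_; applyUpTo)
open import Data.Nat.Base as ℕ using (ℕ; zero; suc; _∸_; _!; parity; z≤n; s≤s)
import Data.Nat.Properties as ℕ
open import Data.Nat.Induction using (<-rec)
open import Data.Parity.Base using (0ℙ; 1ℙ)
open import Data.Product.Base using (∃; _×_; _,_)
open import Data.Rational.Base as ℚ using (ℚ; 0ℚ; 1ℚ)
import Data.Rational.Properties as ℚ
open import Function.Base using (_∘_)
open import Level using (Level; 0ℓ; _⊔_)
open import Relation.Binary.Definitions using (tri<; tri≈; tri>)
open import Relation.Binary.PropositionalEquality as ≡ using (_≡_; _≢_)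
open import Relation.Nullary using (¬_; yes; no; contradiction)
open import Relation.Nullary.Decidable using (¬?; decidable-stable)
import Algebra.Properties.Semiring.Exp as Exp
import Algebra.Properties.Semiring.Sum as Sum
import Algebra.Properties.CommutativeMonoid.Sum as CMSum
import Algebra.Properties.Ring as RingProperties
import Relation.Binary.Reasoning.Setoid as SetoidReasoning
import Algebra.Solver.Ring.NaturalCoefficients.Default as SemiringSolver

private
  variable
    c ℓ : Level

module PowerSeries (R : CommutativeRing c ℓ) where

  open CommutativeRing R
  open Sum semiring
  open SetoidReasoning setoid

  Series : Set c
  Series = ℕ → Carrier

  infix  4 _≋_
  infixl 6 _⊕_
  infixl 7 _⊛_

  _≋_ : Series → Series → Set ℓ
  f ≋ g = ∀ n → f n ≈ g n

  const : Carrier → Series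
  const a zero    = a
  const a (suc n) = 0#

  _⊕_ : Series → Series → Series
  (f ⊕ g) n = f n + g n

  ⊖_ : Series → Series
  (⊖ f) n = - f n

  _⊛_ : Series → Series → Series
  (f ⊛ g) n = ∑[ i ≤ n ] (f (toℕ i) * g (n ∸ toℕ i))

  private
    tail : Series → Series
    tail f n = f (suc n)

  abstract

    ⊛-cong : ∀ {f f′ g g′} → f ≋ f′ → g ≋ g′ → f ⊛ g ≋ f′ ⊛ g′
    ⊛-cong f≋ g≋ n = sum-cong-≋ λ (i : Fin.Fin (suc n)) → *-cong (f≋ (toℕ i)) (g≋ (n ∸ toℕ i))

    -- Peeling off the last instead of the first term of the Cauchy product.
    ⊛-last : ∀ f g n → (f ⊛ g) (suc n) ≈ (f ⊛ tail g) n + f (suc n) * g 0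
    ⊛-last f g zero = lemma (f 0 * g 1) (f 1 * g 0)
      where
      lemma : ∀ x y → x + (y + 0#) ≈ (x + 0#) + y
      lemma x y = trans (+-congˡ (+-identityʳ y)) (+-congʳ (sym (+-identityʳ x)))
    ⊛-last f g (suc n) = begin
      f 0 * g (suc (suc n)) + (tail f ⊛ g) (suc n)
        ≈⟨ +-congˡ (⊛-last (tail f) g n) ⟩
      f 0 * g (suc (suc n)) + ((tail f ⊛ tail g) n + f (suc (suc n)) * g 0)
        ≈⟨ +-assoc _ _ _ ⟨
      (f ⊛ tail g) (suc n) + f (suc (suc n)) * g 0 ∎

    ⊛-comm : ∀ f g → f ⊛ g ≋ g ⊛ f
    ⊛-comm f g zero    = +-congʳ (*-comm (f 0) (g 0))
    ⊛-comm f g (suc n) = begin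
      f 0 * g (suc n) + (tail f ⊛ g) n  ≈⟨ +-cong (*-comm _ _) (⊛-comm (tail f) g n) ⟩
      g (suc n) * f 0 + (g ⊛ tail f) n  ≈⟨ +-comm _ _ ⟩
      (g ⊛ tail f) n + g (suc n) * f 0  ≈⟨ ⊛-last g f n ⟨
      (g ⊛ f) (suc n) ∎

    ⊛-distribʳ : ∀ h f g → (f ⊕ g) ⊛ h ≋ (f ⊛ h) ⊕ (g ⊛ h)
    ⊛-distribʳ h f g n = trans
      (sum-cong-≋ λ (i : Fin.Fin (suc n)) → distribʳ (h (n ∸ toℕ i)) (f (toℕ i)) (g (toℕ i)))
      (∑-distrib-+ {suc n} (λ i → f (toℕ i) * h (n ∸ toℕ i)) (λ i → g (toℕ i) * h (n ∸ toℕ i)))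

    ⊛-distribˡ : ∀ h f g → h ⊛ (f ⊕ g) ≋ (h ⊛ f) ⊕ (h ⊛ g)
    ⊛-distribˡ h f g n = begin
      (h ⊛ (f ⊕ g)) n        ≈⟨ ⊛-comm h (f ⊕ g) n ⟩
      ((f ⊕ g) ⊛ h) n        ≈⟨ ⊛-distribʳ h f g n ⟩
      (f ⊛ h) n + (g ⊛ h) n  ≈⟨ +-cong (⊛-comm f h n) (⊛-comm g h n) ⟩
      (h ⊛ f) n + (h ⊛ g) n  ∎

    ⊛-scale : ∀ a f g n → ((λ k → a * f k) ⊛ g) n ≈ a * (f ⊛ g) n
    ⊛-scale a f g n = trans
      (sum-cong-≋ λ (i : Fin.Fin (suc n)) → *-assoc a (f (toℕ i)) (g (n ∸ toℕ i)))
      (sym (*-distribˡ-sum {suc n} a (λ i → f (toℕ i) * g (n ∸ toℕ i))))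

    ⊛-assoc : ∀ f g h → (f ⊛ g) ⊛ h ≋ f ⊛ (g ⊛ h)
    ⊛-assoc f g h zero = lemma (f 0) (g 0) (h 0)
      where
      lemma : ∀ x y z → (x * y + 0#) * z + 0# ≈ x * (y * z + 0#) + 0#
      lemma x y z = +-congʳ (begin
        (x * y + 0#) * z  ≈⟨ *-congʳ (+-identityʳ _) ⟩
        x * y * z         ≈⟨ *-assoc x y z ⟩
        x * (y * z)       ≈⟨ *-congˡ (+-identityʳ _) ⟨
        x * (y * z + 0#)  ∎)
    ⊛-assoc f g h (suc n) = begin
      (f 0 * g 0 + 0#) * h (suc n) + (tail (f ⊛ g) ⊛ h) n
        ≈⟨ +-cong (trans (*-congʳ (+-identityʳ _)) (*-assoc _ _ _))
                  (⊛-distribʳ h (λ k → f 0 * tail g k) (tail f ⊛ g) n) ⟩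
      f 0 * (g 0 * h (suc n)) + (((λ k → f 0 * tail g k) ⊛ h) n + ((tail f ⊛ g) ⊛ h) n)
        ≈⟨ +-congˡ (+-cong (⊛-scale (f 0) (tail g) h n) (⊛-assoc (tail f) g h n)) ⟩
      f 0 * (g 0 * h (suc n)) + (f 0 * (tail g ⊛ h) n + (tail f ⊛ (g ⊛ h)) n)
        ≈⟨ +-assoc _ _ _ ⟨
      f 0 * (g 0 * h (suc n)) + f 0 * (tail g ⊛ h) n + (tail f ⊛ (g ⊛ h)) n
        ≈⟨ +-congʳ (distribˡ _ _ _) ⟨
      (f ⊛ (g ⊛ h)) (suc n) ∎

    ⊛-identityˡ : ∀ f → const 1# ⊛ f ≋ f
    ⊛-identityˡ f zero    = trans (+-identityʳ _) (*-identityˡ _)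
    ⊛-identityˡ f (suc n) = begin
      1# * f (suc n) + ∑[ i ≤ n ] (0# * f (n ∸ toℕ i))
        ≈⟨ +-cong (*-identityˡ _)
             (trans (sum-cong-≋ λ (i : Fin.Fin (suc n)) → zeroˡ (f (n ∸ toℕ i))) (sum-replicate-zero (suc n))) ⟩
      f (suc n) + 0#  ≈⟨ +-identityʳ _ ⟩
      f (suc n)       ∎

    ⊕-identityˡ : ∀ f → const 0# ⊕ f ≋ f
    ⊕-identityˡ f zero    = +-identityˡ _
    ⊕-identityˡ f (suc n) = +-identityˡ _

    ⊖-inverseˡ : ∀ f → (⊖ f) ⊕ f ≋ const 0#
    ⊖-inverseˡ f zero    = -‿inverseˡ _
    ⊖-inverseˡ f (suc n) = -‿inverseˡ _

  commutativeRing : CommutativeRing c ℓ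
  commutativeRing = record
    { Carrier = Series
    ; _≈_     = _≋_
    ; _+_     = _⊕_
    ; _*_     = _⊛_
    ; -_      = ⊖_
    ; 0#      = const 0#
    ; 1#      = const 1#
    ; isCommutativeRing = record
      { isRing = record
        { +-isAbelianGroup = record
          { isGroup = record
            { isMonoid = record
              { isSemigroup = record
                { isMagma = record
                  { isEquivalence = record
                    { refl  = λ _ → refl
                    ; sym   = λ p n → sym (p n)
                    ; trans = λ p q n → trans (p n) (q n)
                    }
                  ; ∙-cong = λ p q n → +-cong (p n) (q n)
                  }
                ; assoc = λ f g h n → +-assoc (f n) (g n) (h n)
                }
              ; identity = ⊕-identityˡ , λ f n → trans (+-comm (f n) _) (⊕-identityˡ f n)
              }
            ; inverse = ⊖-inverseˡ , λ f n → trans (+-comm (f n) _) (⊖-inverseˡ f n)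
            ; ⁻¹-cong = λ p n → -‿cong (p n)
            }
          ; comm = λ f g n → +-comm (f n) (g n)
          }
        ; *-cong     = ⊛-cong
        ; *-assoc    = ⊛-assoc
        ; *-identity = ⊛-identityˡ , λ f n → trans (⊛-comm f (const 1#) n) (⊛-identityˡ f n)
        ; distrib    = ⊛-distribˡ , ⊛-distribʳ
        }
      ; *-comm = ⊛-comm
      }
    }

  abstract

    sum-zero : ∀ n (f : Series) → (∀ i → i ℕ.≤ n → f i ≈ 0#) → ∑[ i ≤ n ] f (toℕ i) ≈ 0#
    sum-zero n f f≈0 = trans
      (sum-cong-≋ λ (i : Fin.Fin (suc n)) → f≈0 (toℕ i) (ℕ.s≤s⁻¹ (Fin.toℕ<n i)))
      (sum-replicate-zero (suc n))

    sum-single : ∀ n k (f : Series) → k ℕ.≤ n → (∀ i → i ℕ.≤ n → i ≢ k → f i ≈ 0#) →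
                 ∑[ i ≤ n ] f (toℕ i) ≈ f k
    sum-single zero zero f z≤n f≈0 = +-identityʳ _
    sum-single (suc n) zero f z≤n f≈0 = trans
      (+-congˡ (sum-zero n (tail f) λ i i≤n → f≈0 (suc i) (s≤s i≤n) λ ()))
      (+-identityʳ _)
    sum-single (suc n) (suc k) f (s≤s k≤n) f≈0 = trans
      (+-cong (f≈0 0 z≤n λ ())
        (sum-single n k (tail f) k≤n λ i i≤n i≢k → f≈0 (suc i) (s≤s i≤n) (i≢k ∘ ℕ.suc-injective)))
      (+-identityˡ _)

-- Polynomials are the power series with finitely many nonzero coefficients;
-- equality compares coefficients only, not the (non-unique) bounds.
module Polynomials (R : CommutativeRing c ℓ) where

  open CommutativeRing R
  open RingProperties ring using (-0#≈0#)
  open PowerSeries R using (Series; const; _⊕_; ⊖_; _⊛_; sum-zero)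
  private module S = CommutativeRing (PowerSeries.commutativeRing R)

  record Poly : Set (c ⊔ ℓ) where
    constructor poly
    field
      coeff  : Series
      bound  : ℕ
      vanish : ∀ n → bound ℕ.≤ n → coeff n ≈ 0#

  open Poly public

  constant : Carrier → Poly
  constant a = poly (const a) 1 λ { (suc n) _ → refl }

  indeterminate : Poly
  indeterminate = poly coeffs 2 λ { (suc (suc n)) _ → refl ; (suc zero) (s≤s ()) }
    where
    coeffs : Series
    coeffs 1 = 1#
    coeffs _ = 0#

  _+ᴾ_ : Poly → Poly → Poly
  poly f a f≈0 +ᴾ poly g b g≈0 = poly (f ⊕ g) (a ℕ.⊔ b) λ n le → trans
    (+-cong (f≈0 n (ℕ.≤-trans (ℕ.m≤m⊔n a b) le)) (g≈0 n (ℕ.≤-trans (ℕ.m≤n⊔m a b) le)))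
    (+-identityˡ 0#)

  -ᴾ_ : Poly → Poly
  -ᴾ poly f a f≈0 = poly (⊖ f) a λ n le → trans (-‿cong (f≈0 n le)) -0#≈0#

  _*ᴾ_ : Poly → Poly → Poly
  poly f a f≈0 *ᴾ poly g b g≈0 = poly (f ⊛ g) (a ℕ.+ b) vanishes
    where
    abstract
      vanishes : ∀ n → a ℕ.+ b ℕ.≤ n → (f ⊛ g) n ≈ 0#
      vanishes n le = sum-zero n (λ i → f i * g (n ∸ i)) term
        where
        term : ∀ i → i ℕ.≤ n → f i * g (n ∸ i) ≈ 0#
        term i _ with a ℕ.≤? i
        ... | yes a≤i = trans (*-congʳ (f≈0 i a≤i)) (zeroˡ _)
        ... | no  a≰i = trans (*-congˡ (g≈0 (n ∸ i) b≤n∸i)) (zeroʳ _)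
          where
          b≤n∸i : b ℕ.≤ n ∸ i
          b≤n∸i = ℕ.m+n≤o⇒m≤o∸n b
            (ℕ.≤-trans (ℕ.≤-reflexive (ℕ.+-comm b i))
              (ℕ.≤-trans (ℕ.+-monoˡ-≤ b (ℕ.<⇒≤ (ℕ.≰⇒> a≰i))) le))

  commutativeRing : CommutativeRing (c ⊔ ℓ) ℓ
  commutativeRing = record
    { Carrier = Poly
    ; _≈_     = λ p q → coeff p S.≈ coeff q
    ; _+_     = _+ᴾ_
    ; _*_     = _*ᴾ_
    ; -_      = -ᴾ_
    ; 0#      = constant 0#
    ; 1#      = constant 1#
    ; isCommutativeRing = record
      { isRing = record
        { +-isAbelianGroup = record
          { isGroup = record
            { isMonoid = record
              { isSemigroup = record
                { isMagma = record
                  { isEquivalence = record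
                    { refl  = S.refl
                    ; sym   = S.sym
                    ; trans = S.trans
                    }
                  ; ∙-cong = S.+-cong
                  }
                ; assoc = λ p q r → S.+-assoc (coeff p) (coeff q) (coeff r)
                }
              ; identity = (λ p → S.+-identityˡ (coeff p)) , λ p → S.+-identityʳ (coeff p)
              }
            ; inverse = (λ p → S.-‿inverseˡ (coeff p)) , λ p → S.-‿inverseʳ (coeff p)
            ; ⁻¹-cong = S.-‿cong
            }
          ; comm = λ p q → S.+-comm (coeff p) (coeff q)
          }
        ; *-cong     = S.*-cong
        ; *-assoc    = λ p q r → S.*-assoc (coeff p) (coeff q) (coeff r)
        ; *-identity = (λ p → S.*-identityˡ (coeff p)) , λ p → S.*-identityʳ (coeff p)
        ; distrib    = (λ p q r → S.distribˡ (coeff p) (coeff q) (coeff r))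
                     , (λ p q r → S.distribʳ (coeff p) (coeff q) (coeff r))
        }
      ; *-comm = λ p q → S.*-comm (coeff p) (coeff q)
      }
    }

record IsIntegralDomain (D : CommutativeRing c ℓ) : Set (c ⊔ ℓ) where
  open CommutativeRing D
  field
    1≉0            : ¬ 1# ≈ 0#
    noZeroDivisors : ∀ x y → ¬ x ≈ 0# → x * y ≈ 0# → y ≈ 0#

module Fractions (D : CommutativeRing c ℓ) (isDomain : IsIntegralDomain D) where

  open CommutativeRing D
  open IsIntegralDomain isDomain
  open RingProperties ring
  open SetoidReasoning setoid

  open SemiringSolver commutativeSemiring using (solve; _:+_; _:*_; _:=_)

  record Fraction : Set (c ⊔ ℓ) where
    constructor fraction
    field
      num   : Carrier
      den   : Carrier
      den≉0 : ¬ den ≈ 0#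

  open Fraction public

  infix 4 _≃_

  _≃_ : Fraction → Fraction → Set ℓ
  x ≃ y = num x * den y ≈ num y * den x

  *-≉0 : ∀ {x y} → ¬ x ≈ 0# → ¬ y ≈ 0# → ¬ x * y ≈ 0#
  *-≉0 x≉0 y≉0 xy≈0 = y≉0 (noZeroDivisors _ _ x≉0 xy≈0)

  embed : Carrier → Fraction
  embed a = fraction a 1# 1≉0

  _+ᶠ_ : Fraction → Fraction → Fraction
  fraction a b b≉0 +ᶠ fraction a′ b′ b′≉0 = fraction (a * b′ + a′ * b) (b * b′) (*-≉0 b≉0 b′≉0)

  _*ᶠ_ : Fraction → Fraction → Fraction
  fraction a b b≉0 *ᶠ fraction a′ b′ b′≉0 = fraction (a * a′) (b * b′) (*-≉0 b≉0 b′≉0)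

  -ᶠ_ : Fraction → Fraction
  -ᶠ fraction a b b≉0 = fraction (- a) b b≉0

  abstract

    private
      *-cancelˡ : ∀ x y z → ¬ x ≈ 0# → x * y ≈ x * z → y ≈ z
      *-cancelˡ x y z x≉0 eq = x∙y⁻¹≈ε⇒x≈y y z (noZeroDivisors x (y - z) x≉0 (begin
        x * (y - z)    ≈⟨ x[y-z]≈xy-xz x y z ⟩
        x * y - x * z  ≈⟨ +-congʳ eq ⟩
        x * z - x * z  ≈⟨ -‿inverseʳ _ ⟩
        0#             ∎))

    ≃-trans : ∀ {x y z} → x ≃ y → y ≃ z → x ≃ z
    ≃-trans {fraction a b b≉0} {fraction a′ b′ b′≉0} {fraction a″ b″ b″≉0} p q =
      *-cancelˡ b′ _ _ b′≉0 (begin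
        b′ * (a * b″)   ≈⟨ l₁ b′ a b″ ⟩
        (a * b′) * b″   ≈⟨ *-congʳ p ⟩
        (a′ * b) * b″   ≈⟨ l₂ a′ b b″ ⟩
        (a′ * b″) * b   ≈⟨ *-congʳ q ⟩
        (a″ * b′) * b   ≈⟨ l₁′ a″ b′ b ⟩
        b′ * (a″ * b)   ∎)
      where
      l₁ : ∀ x y z → x * (y * z) ≈ (y * x) * z
      l₁ = solve 3 (λ x y z → x :* (y :* z) := (y :* x) :* z) refl
      l₁′ : ∀ x y z → (x * y) * z ≈ y * (x * z)
      l₁′ = solve 3 (λ x y z → (x :* y) :* z := y :* (x :* z)) refl
      l₂ : ∀ x y z → (x * y) * z ≈ (x * z) * y
      l₂ = solve 3 (λ x y z → (x :* y) :* z := (x :* z) :* y) refl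

    +ᶠ-cong : ∀ {x x′ y y′} → x ≃ x′ → y ≃ y′ → (x +ᶠ y) ≃ (x′ +ᶠ y′)
    +ᶠ-cong {fraction a b _} {fraction a′ b′ _} {fraction d e _} {fraction d′ e′ _} p q = begin
      (a * e + d * b) * (b′ * e′)               ≈⟨ l a e d b b′ e′ ⟩
      (a * b′) * (e * e′) + (d * e′) * (b * b′) ≈⟨ +-cong (*-congʳ p) (*-congʳ q) ⟩
      (a′ * b) * (e * e′) + (d′ * e) * (b * b′) ≈⟨ r a′ b e e′ d′ b′ ⟩
      (a′ * e′ + d′ * b′) * (b * e)             ∎
      where
      l : ∀ a e d b b′ e′ →
          (a * e + d * b) * (b′ * e′)
          ≈ (a * b′) * (e * e′) + (d * e′) * (b * b′)
      l = solve 6 (λ a e d b b′ e′ →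
          (a :* e :+ d :* b) :* (b′ :* e′)
          := (a :* b′) :* (e :* e′) :+ (d :* e′) :* (b :* b′)) refl
      r : ∀ a′ b e e′ d′ b′ →
          (a′ * b) * (e * e′) + (d′ * e) * (b * b′)
          ≈ (a′ * e′ + d′ * b′) * (b * e)
      r = solve 6 (λ a′ b e e′ d′ b′ →
          (a′ :* b) :* (e :* e′) :+ (d′ :* e) :* (b :* b′)
          := (a′ :* e′ :+ d′ :* b′) :* (b :* e)) refl

    *ᶠ-cong : ∀ {x x′ y y′} → x ≃ x′ → y ≃ y′ → (x *ᶠ y) ≃ (x′ *ᶠ y′)
    *ᶠ-cong {fraction a b _} {fraction a′ b′ _} {fraction d e _} {fraction d′ e′ _} p q = begin
      (a * d) * (b′ * e′)  ≈⟨ l a d b′ e′ ⟩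
      (a * b′) * (d * e′)  ≈⟨ *-cong p q ⟩
      (a′ * b) * (d′ * e)  ≈⟨ l a′ b d′ e ⟩
      (a′ * d′) * (b * e)  ∎
      where
      l : ∀ x y z w → (x * y) * (z * w) ≈ (x * z) * (y * w)
      l = solve 4 (λ x y z w → (x :* y) :* (z :* w) := (x :* z) :* (y :* w)) refl

    -ᶠ-cong : ∀ {x x′} → x ≃ x′ → (-ᶠ x) ≃ (-ᶠ x′)
    -ᶠ-cong {fraction a b _} {fraction a′ b′ _} p = begin
      - a * b′    ≈⟨ -‿distribˡ-* a b′ ⟨
      - (a * b′)  ≈⟨ -‿cong p ⟩
      - (a′ * b)  ≈⟨ -‿distribˡ-* a′ b ⟩
      - a′ * b    ∎

    +ᶠ-assoc : ∀ x y z → ((x +ᶠ y) +ᶠ z) ≃ (x +ᶠ (y +ᶠ z))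
    +ᶠ-assoc (fraction a b _) (fraction d e _) (fraction g h _) = l a b d e g h
      where
      l : ∀ a b d e g h →
          ((a * e + d * b) * h + g * (b * e)) * (b * (e * h))
          ≈ (a * (e * h) + (d * h + g * e) * b) * ((b * e) * h)
      l = solve 6 (λ a b d e g h →
          ((a :* e :+ d :* b) :* h :+ g :* (b :* e)) :* (b :* (e :* h))
          := (a :* (e :* h) :+ (d :* h :+ g :* e) :* b) :* ((b :* e) :* h)) refl

    +ᶠ-comm : ∀ x y → (x +ᶠ y) ≃ (y +ᶠ x)
    +ᶠ-comm (fraction a b _) (fraction d e _) = *-cong (+-comm _ _) (*-comm e b)

    +ᶠ-identityˡ : ∀ x → (embed 0# +ᶠ x) ≃ x
    +ᶠ-identityˡ (fraction a b _) = begin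
      (0# * b + a * 1#) * b  ≈⟨ *-congʳ (+-cong (zeroˡ b) (*-identityʳ a)) ⟩
      (0# + a) * b           ≈⟨ *-cong (+-identityˡ a) (sym (*-identityˡ b)) ⟩
      a * (1# * b)           ∎

    -ᶠ-inverseˡ : ∀ x → ((-ᶠ x) +ᶠ x) ≃ embed 0#
    -ᶠ-inverseˡ (fraction a b _) = begin
      (- a * b + a * b) * 1#  ≈⟨ *-identityʳ _ ⟩
      - a * b + a * b         ≈⟨ distribʳ b (- a) a ⟨
      (- a + a) * b           ≈⟨ *-congʳ (-‿inverseˡ a) ⟩
      0# * b                  ≈⟨ zeroˡ b ⟩
      0#                      ≈⟨ zeroˡ _ ⟨
      0# * (b * b)            ∎

    *ᶠ-assoc : ∀ x y z → ((x *ᶠ y) *ᶠ z) ≃ (x *ᶠ (y *ᶠ z))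
    *ᶠ-assoc (fraction a b _) (fraction d e _) (fraction g h _) =
      *-cong (*-assoc a d g) (sym (*-assoc b e h))

    *ᶠ-comm : ∀ x y → (x *ᶠ y) ≃ (y *ᶠ x)
    *ᶠ-comm (fraction a b _) (fraction d e _) = *-cong (*-comm a d) (*-comm e b)

    *ᶠ-identityˡ : ∀ x → (embed 1# *ᶠ x) ≃ x
    *ᶠ-identityˡ (fraction a b _) = *-cong (*-identityˡ a) (sym (*-identityˡ b))

    *ᶠ-distribˡ : ∀ x y z → (x *ᶠ (y +ᶠ z)) ≃ ((x *ᶠ y) +ᶠ (x *ᶠ z))
    *ᶠ-distribˡ (fraction a b _) (fraction d e _) (fraction g h _) = l a b d e g h
      where
      l : ∀ a b d e g h →
          (a * (d * h + g * e)) * ((b * e) * (b * h))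
          ≈ ((a * d) * (b * h) + (a * g) * (b * e)) * (b * (e * h))
      l = solve 6 (λ a b d e g h →
          (a :* (d :* h :+ g :* e)) :* ((b :* e) :* (b :* h))
          := ((a :* d) :* (b :* h) :+ (a :* g) :* (b :* e)) :* (b :* (e :* h))) refl

    *ᶠ-distribʳ : ∀ x y z → ((y +ᶠ z) *ᶠ x) ≃ ((y *ᶠ x) +ᶠ (z *ᶠ x))
    *ᶠ-distribʳ x y z = ≃-trans {(y +ᶠ z) *ᶠ x} {x *ᶠ (y +ᶠ z)} {(y *ᶠ x) +ᶠ (z *ᶠ x)}
      (*ᶠ-comm (y +ᶠ z) x)
      (≃-trans {x *ᶠ (y +ᶠ z)} {(x *ᶠ y) +ᶠ (x *ᶠ z)} {(y *ᶠ x) +ᶠ (z *ᶠ x)}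
        (*ᶠ-distribˡ x y z)
        (+ᶠ-cong {x *ᶠ y} {y *ᶠ x} {x *ᶠ z} {z *ᶠ x} (*ᶠ-comm x y) (*ᶠ-comm x z)))

  commutativeRing : CommutativeRing (c ⊔ ℓ) ℓ
  commutativeRing = record
    { Carrier = Fraction
    ; _≈_     = _≃_
    ; _+_     = _+ᶠ_
    ; _*_     = _*ᶠ_
    ; -_      = -ᶠ_
    ; 0#      = embed 0#
    ; 1#      = embed 1#
    ; isCommutativeRing = record
      { isRing = record
        { +-isAbelianGroup = record
          { isGroup = record
            { isMonoid = record
              { isSemigroup = record
                { isMagma = record
                  { isEquivalence = record
                    { refl  = refl
                    ; sym   = sym
                    ; trans = λ {x} {y} {z} → ≃-trans {x} {y} {z}
                    }
                  ; ∙-cong = λ {x} {y} {u} {v} → +ᶠ-cong {x} {y} {u} {v}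
                  }
                ; assoc = +ᶠ-assoc
                }
              ; identity = +ᶠ-identityˡ , λ x →
                  ≃-trans {x +ᶠ embed 0#} {embed 0# +ᶠ x} {x} (+ᶠ-comm x (embed 0#)) (+ᶠ-identityˡ x)
              }
            ; inverse = -ᶠ-inverseˡ , λ x →
                ≃-trans {x +ᶠ (-ᶠ x)} {(-ᶠ x) +ᶠ x} {embed 0#} (+ᶠ-comm x (-ᶠ x)) (-ᶠ-inverseˡ x)
            ; ⁻¹-cong = λ {x} {y} → -ᶠ-cong {x} {y}
            }
          ; comm = +ᶠ-comm
          }
        ; *-cong     = λ {x} {y} {u} {v} → *ᶠ-cong {x} {y} {u} {v}
        ; *-assoc    = *ᶠ-assoc
        ; *-identity = *ᶠ-identityˡ , λ x →
            ≃-trans {x *ᶠ embed 1#} {embed 1# *ᶠ x} {x} (*ᶠ-comm x (embed 1#)) (*ᶠ-identityˡ x)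
        ; distrib    = *ᶠ-distribˡ , *ᶠ-distribʳ
        }
      ; *-comm = *ᶠ-comm
      }
    }

  ≄0⇒num≉0 : ∀ x → ¬ x ≃ embed 0# → ¬ num x ≈ 0#
  ≄0⇒num≉0 x x≄0 n≈0 = x≄0 (begin
    num x * 1#   ≈⟨ *-identityʳ _ ⟩
    num x        ≈⟨ n≈0 ⟩
    0#           ≈⟨ zeroˡ _ ⟨
    0# * den x   ∎)

  inv : ∀ x → ¬ x ≃ embed 0# → Fraction
  inv x x≄0 = fraction (den x) (num x) (≄0⇒num≉0 x x≄0)

  abstract

    inv-inverseʳ : ∀ x (x≄0 : ¬ x ≃ embed 0#) → (x *ᶠ inv x x≄0) ≃ embed 1#
    inv-inverseʳ x x≄0 = begin
      num x * den x * 1#    ≈⟨ *-identityʳ _ ⟩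
      num x * den x         ≈⟨ *-comm _ _ ⟩
      den x * num x         ≈⟨ *-identityˡ _ ⟨
      1# * (den x * num x)  ∎

    embed-cong : ∀ {a b} → a ≈ b → embed a ≃ embed b
    embed-cong = *-congʳ

    embed-injective : ∀ {a b} → embed a ≃ embed b → a ≈ b
    embed-injective p = trans (sym (*-identityʳ _)) (trans p (*-identityʳ _))

    embed-+ : ∀ a b → embed (a + b) ≃ (embed a +ᶠ embed b)
    embed-+ a b = *-cong (sym (+-cong (*-identityʳ a) (*-identityʳ b))) (*-identityˡ 1#)

    embed-* : ∀ a b → embed (a * b) ≃ (embed a *ᶠ embed b)
    embed-* a b = *-congˡ (*-identityˡ 1#)

  private
    module K = CommutativeRing commutativeRing
  open Exp semiring using (_^_)
  open Exp K.semiring using () renaming (_^_ to _^ᶠ_)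

  abstract

    embed-^ : ∀ a n → embed (a ^ n) ≃ (embed a ^ᶠ n)
    embed-^ a zero    = refl
    embed-^ a (suc n) = ≃-trans {embed (a ^ suc n)} {embed a *ᶠ embed (a ^ n)} {embed a ^ᶠ suc n}
      (embed-* a (a ^ n))
      (*ᶠ-cong {embed a} {embed a} {embed (a ^ n)} {embed a ^ᶠ n} refl (embed-^ a n))

    1-embed^≄0 : ∀ a n → ¬ 1# ≈ a ^ n → ¬ (embed 1# K.- (embed a ^ᶠ n)) ≃ embed 0#
    1-embed^≄0 a n 1≉aⁿ eq = 1≉aⁿ (embed-injective (≃-trans {embed 1#} {embed a ^ᶠ n} {embed (a ^ n)}
      (RingProperties.x∙y⁻¹≈ε⇒x≈y K.ring (embed 1#) (embed a ^ᶠ n) eq)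
      (K.sym {embed (a ^ n)} {embed a ^ᶠ n} (embed-^ a n))))

-- ι is to be thought of as the structure map of a ℚ-algebra.

module Exponential (K : CommutativeRing c ℓ) (ι : ℚ → CommutativeRing.Carrier K) where

  open CommutativeRing K
  open Sum semiring using (sum⁺-syntax)
  open PowerSeries K
  private
    module S = CommutativeRing commutativeRing
  open Exp S.semiring using () renaming (_^_ to _^ˢ_)

  -- exp A = Σₖ Aᵏ / k!.  When A has zero constant term (the only case in
  -- which the formal exponential is defined), Aᵏ has no terms of degree
  -- below k (see ^ˢ-order), so the sum for the nth coefficient stops at k = n.
  exp : Series → Series
  exp A n = ∑[ k ≤ n ] (ι (ℚ._/_ (+ 1) (toℕ k !) {{ toℕ k ℕ.!≢0 }}) * (A ^ˢ toℕ k) n)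

  abstract

    ^ˢ-order : ∀ A → A 0 ≈ 0# → ∀ k n → n ℕ.< k → (A ^ˢ k) n ≈ 0#
    ^ˢ-order A A₀≈0 (suc k) n (s≤s n≤k) = sum-zero n (λ i → A i * (A ^ˢ k) (n ∸ i)) term
      where
      term : ∀ i → i ℕ.≤ n → A i * (A ^ˢ k) (n ∸ i) ≈ 0#
      term zero    _   = trans (*-congʳ A₀≈0) (zeroˡ _)
      term (suc i) i<n = trans
        (*-congˡ (^ˢ-order A A₀≈0 k (n ∸ suc i)
          (ℕ.<-≤-trans (ℕ.∸-monoʳ-< {n} {suc i} {0} (s≤s z≤n) i<n) n≤k)))
        (zeroʳ _)

-- All length-k sublists, one for each k-element set of positions.
choose : ∀ {a} {A : Set a} → ℕ → List A → List (List A)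
choose zero    xs       = [] ∷ []
choose (suc k) []       = []
choose (suc k) (x ∷ xs) = List.map (x ∷_) (choose k xs) ++ choose (suc k) xs

module Symmetric (K : CommutativeRing c ℓ) where

  open CommutativeRing K

  elementary : ℕ → List Carrier → Carrier
  elementary k xs = List.foldr _+_ 0# (List.map (List.foldr _*_ 1#) (choose k xs))

ℚ-ring : CommutativeRing 0ℓ 0ℓ
ℚ-ring = ℚ.+-*-commutativeRing

ℚ[t] : CommutativeRing 0ℓ 0ℓ
ℚ[t] = Polynomials.commutativeRing ℚ-ring

private
  module P = CommutativeRing ℚ[t]
open Polynomials ℚ-ring using (Poly; coeff; constant; indeterminate)

abstract

  1≉0 : ¬ P.1# P.≈ P.0#
  1≉0 eq with () ← eq 0

  private
    ℚ-noZeroDivisors : ∀ p q → p ≢ 0ℚ → q ℚ.* p ≡ 0ℚ → q ≡ 0ℚ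
    ℚ-noZeroDivisors p q p≢0 qp≡0 = begin
      q                    ≡⟨ ℚ.*-identityʳ q ⟨
      q ℚ.* 1ℚ             ≡⟨ ≡.cong (q ℚ.*_) (ℚ.*-inverseʳ p) ⟨
      q ℚ.* (p ℚ.* ℚ.1/ p) ≡⟨ ℚ.*-assoc q p (ℚ.1/ p) ⟨
      q ℚ.* p ℚ.* ℚ.1/ p   ≡⟨ ≡.cong (ℚ._* ℚ.1/ p) qp≡0 ⟩
      0ℚ ℚ.* ℚ.1/ p        ≡⟨ ℚ.*-zeroˡ (ℚ.1/ p) ⟩
      0ℚ                   ∎
      where
      open ≡.≡-Reasoning
      instance
        _ : ℚ.NonZero p
        _ = ℚ.≢-nonZero p≢0

    -- A series with a nonzero coefficient has a first one.
    Leading : (ℕ → ℚ) → Set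
    Leading g = ∃ λ k → g k ≢ 0ℚ × (∀ i → i ℕ.< k → g i ≡ 0ℚ)

    leading : ∀ g n → g n ≢ 0ℚ → Leading g
    leading g = <-rec (λ n → g n ≢ 0ℚ → Leading g) step
      where
      step : ∀ n → (∀ {m} → m ℕ.< n → g m ≢ 0ℚ → Leading g) → g n ≢ 0ℚ → Leading g
      step n rec gn≢0 with ℕ.anyUpTo? (λ i → ¬? (g i ℚ.≟ 0ℚ)) n
      ... | yes (m , m<n , gm≢0) = rec m<n gm≢0
      ... | no  none = n , gn≢0 , λ i i<n →
              decidable-stable (g i ℚ.≟ 0ℚ) (λ gi≢0 → none (i , i<n , gi≢0))

  noZeroDivisors : ∀ p q → ¬ p P.≈ P.0# → p P.* q P.≈ P.0# → q P.≈ P.0#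
  noZeroDivisors p q p≉0 pq≈0 n = decidable-stable (coeff q n ℚ.≟ coeff P.0# n) λ qn≢ →
    p≉0 (λ m → ≡.trans (main (leading g n (λ e → qn≢ (≡.trans e (≡.sym (0-coeff n))))) m) (≡.sym (0-coeff m)))
    where
    f g : ℕ → ℚ
    f = coeff p
    g = coeff q

    0-coeff : ∀ n → coeff P.0# n ≡ 0ℚ
    0-coeff zero    = ≡.refl
    0-coeff (suc n) = ≡.refl

    main : Leading g → ∀ m → f m ≡ 0ℚ
    main (k , gk≢0 , g<k≡0) = <-rec (λ m → f m ≡ 0ℚ) step
      where
      step : ∀ m → (∀ {i} → i ℕ.< m → f i ≡ 0ℚ) → f m ≡ 0ℚ
      step m rec = ℚ-noZeroDivisors (g k) (f m) gk≢0 (begin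
        f m ℚ.* g k              ≡⟨ ≡.cong (λ j → f m ℚ.* g j) (ℕ.m+n∸m≡n m k) ⟨
        f m ℚ.* g (m ℕ.+ k ∸ m)  ≡⟨ PowerSeries.sum-single ℚ-ring (m ℕ.+ k) m
                                       (λ i → f i ℚ.* g (m ℕ.+ k ∸ i)) (ℕ.m≤m+n m k) other ⟨
        coeff (p P.* q) (m ℕ.+ k) ≡⟨ pq≈0 (m ℕ.+ k) ⟩
        coeff P.0# (m ℕ.+ k)      ≡⟨ 0-coeff (m ℕ.+ k) ⟩
        0ℚ                        ∎)
        where
        open ≡.≡-Reasoning
        other : ∀ i → i ℕ.≤ m ℕ.+ k → i ≢ m → f i ℚ.* g (m ℕ.+ k ∸ i) ≡ 0ℚ
        other i i≤ i≢m with ℕ.<-cmp i m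
        ... | tri< i<m _ _ = ≡.trans (≡.cong (ℚ._* g (m ℕ.+ k ∸ i)) (rec i<m)) (ℚ.*-zeroˡ (g (m ℕ.+ k ∸ i)))
        ... | tri≈ _ i≡m _ = contradiction i≡m i≢m
        ... | tri> _ _ i>m = ≡.trans (≡.cong (f i ℚ.*_) (g<k≡0 _ lt)) (ℚ.*-zeroʳ (f i))
          where
          lt : m ℕ.+ k ∸ i ℕ.< k
          lt = ≡.subst (m ℕ.+ k ∸ i ℕ.<_) (ℕ.m+n∸m≡n m k)
                 (ℕ.∸-monoʳ-< {m ℕ.+ k} {i} {m} i>m i≤)

ℚ[t]-isDomain : IsIntegralDomain ℚ[t]
ℚ[t]-isDomain = record { 1≉0 = 1≉0 ; noZeroDivisors = noZeroDivisors }

module ℚ⟨t⟩ = Fractions ℚ[t] ℚ[t]-isDomain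

ℚ⟨t⟩-ring : CommutativeRing 0ℓ 0ℓ
ℚ⟨t⟩-ring = ℚ⟨t⟩.commutativeRing

open CommutativeRing ℚ⟨t⟩-ring public
  using (_≈_; _+_; _*_; -_; _-_; 0#; 1#)
  renaming (Carrier to ℚ⟨t⟩)
private
  module K = CommutativeRing ℚ⟨t⟩-ring
open Exp K.semiring public using (_^_)
open Sum K.semiring public using (sum-syntax; sum⁺-syntax)

open CMSum K.*-commutativeMonoid using () renaming (sum to product)

t : ℚ⟨t⟩
t = ℚ⟨t⟩.embed indeterminate

rational : ℚ → ℚ⟨t⟩
rational q = ℚ⟨t⟩.embed (constant q)

open PowerSeries ℚ⟨t⟩-ring public using (Series)
open Exponential ℚ⟨t⟩-ring rational public using (exp)
open Symmetric ℚ⟨t⟩-ring public using (elementary)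

abstract

  1-tⁿ≉0 : ∀ n → ¬ 1# - t ^ suc n ≈ 0#
  1-tⁿ≉0 n = ℚ⟨t⟩.1-embed^≄0 indeterminate (suc n) λ eq → contradiction
    (≡.trans (eq 0) (≡.trans (ℚ.+-identityʳ (0ℚ ℚ.* coeff (indeterminate ^ᴾ n) 0))
                             (ℚ.*-zeroˡ (coeff (indeterminate ^ᴾ n) 0))))
    λ ()
    where open Exp P.semiring using () renaming (_^_ to _^ᴾ_)

-- 1 / (1 - tᵏ⁺¹)
1/[1-t^1+_] : ℕ → ℚ⟨t⟩
1/[1-t^1+ k ] = ℚ⟨t⟩.inv (1# - t ^ suc k) (1-tⁿ≉0 k)

-- -2 Σ_{n odd} (1 - sⁿ)/(1 - tⁿ) uⁿ/n
exponent : ℚ⟨t⟩ → Series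
exponent s zero = 0#
exponent s (suc k) with parity (suc k)
... | 0ℙ = 0#
... | 1ℙ = rational (-[1+ 1 ] ℚ./ 1)
             * ((1# - s ^ suc k) * 1/[1-t^1+ k ] * rational (+ 1 ℚ./ suc k))

F : ℚ⟨t⟩ → Series
F s = exp (exponent s)

f[_] : ℕ → ℕ → ℚ⟨t⟩
f[ M ] m = F (t ^ M) m

e[_] : ℕ → ℕ → ℚ⟨t⟩
e[ M ] j = elementary j (applyUpTo (t ^_) M)

-- ∏_{0 ≤ i < k} (1 - tⁿ⁻ⁱ)/(1 - tⁱ⁺¹); for k > n the factor i = n vanishes,
-- so truncated subtraction in the exponent is harmless.
gaussian : ℕ → ℕ → ℚ⟨t⟩
gaussian n k = product {k} (λ i → (1# - t ^ (n ∸ toℕ i)) * 1/[1-t^1+ toℕ i ])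

{-# OPTIONS --safe #-}
module Submission where

-- Put E(u) = Σⱼ eⱼ uʲ = ∏ (1 + xᵢu) for the M elements xᵢ = tⁱ.
-- Since (1 - t^{Mn})/(1 - tⁿ) is the power sum Σᵢ xᵢⁿ, the series F is formally
-- ∏ (1 - xᵢu)/(1 + xᵢu), and the convolution identity says E(u) F(u) = E(-u).
-- No logarithm is needed: with the Euler operator θ = u d/du,
--   θE = p E        where p = Σᵢ xᵢu/(1 + xᵢu)            (θ-elementarySeries),
--   θ(exp A) = θA exp A   for every A without constant term (θ-exp),
-- and when A is the exponent of F, θA = -2 Σ_{n odd} (Σᵢ xᵢⁿ) uⁿ, that is,
-- p + θA = p(-u) (logDeriv-⊕).  Hence E F and E(-u) both solve θX = p(-u) X, with
-- the same constant term.  In characteristic zero such an equation determines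
-- every coefficient from the earlier ones, because p(0) = 0 (θ-unique), so the two
-- series agree.  Truncation of the sums at M is harmless as eⱼ = 0 for j > M,
-- and e₀ = 1 isolates f_m in the recurrence.
--
-- The formula eⱼ = t^{j(j-1)/2} [M, j] follows by induction on M.  Splitting off
-- the element 1 from 1, t, …, t^M leaves t times the elements 1, …, t^{M-1}, which
-- gives a recursion for eⱼ (elementary-∷, elementary-applyUpTo-suc); the Gaussian
-- binomials satisfy the matching q-Pascal rule (pascal), itself a consequence of
-- absorption.
--
-- All arguments are carried out over an arbitrary commutative ring, which is
-- a ℚ-algebra or has inverses of 1 - tⁿ where needed, and specialised to ℚ(t) last.

open import Algebra.Bundles using (CommutativeRing)
open import Algebra.Morphism.Structures using (IsRingHomomorphism)
import Algebra.Properties.CommutativeMonoid.Mult as CommutativeMonoidMult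
import Algebra.Properties.CommutativeSemigroup as CommutativeSemigroupProperties
import Algebra.Properties.CommutativeSemiring.Exp as CommutativeExp
import Algebra.Properties.Monoid.Sum as MonoidSum
import Algebra.Properties.Ring as RingProperties
import Algebra.Properties.Semiring.Exp as Exp
import Algebra.Properties.Semiring.Mult as Mult
import Algebra.Properties.Semiring.Sum as Sum
open import Data.Fin as Fin using (Fin; toℕ)
import Data.Fin.Properties as Fin
open import Data.Integer.Base as ℤ using (+_; -[1+_])
import Data.Integer.Properties as ℤ
open import Data.List.Base as List using (List; []; _∷_; _++_; applyUpTo)
open import Data.List.Properties using (map-++; length-applyUpTo)
open import Data.Nat using (ℕ; zero; suc; _≤_; _<_; _⊓_; _∸_; _!; parity; z≤n; s≤s; NonZero)
import Data.Nat.Base as ℕ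
open import Data.Nat.Combinatorics using (_C_; nCk+nC[k+1]≡[n+1]C[k+1]; nC1≡n)
import Data.Nat.Properties as ℕ
open import Data.Parity.Base as ℙ using (Parity; 0ℙ; 1ℙ)
open import Data.Parity.Properties using (suc-homo-⁻¹)
open import Data.Rational.Base as ℚ using (ℚ; _/_; toℚᵘ; 1ℚ)
import Data.Rational.Properties as ℚ
import Data.Rational.Unnormalised.Base as ℚᵘ
import Data.Rational.Unnormalised.Properties as ℚᵘ
open import Data.Sum.Base using (inj₁; inj₂)
open import Function.Base using (_∘_)
open import Relation.Binary.PropositionalEquality as ≡ using (_≡_; _≗_)
import Relation.Binary.Reasoning.Setoid as SetoidReasoning
open import Relation.Nullary using (yes; no; contradiction)
open import Defs using (module PowerSeries; module Exponential; module Symmetric; choose; ℚ-ring)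

-- Formal power series and the Euler operator

module FormalSeries {c ℓ} (R : CommutativeRing c ℓ) where

  open CommutativeRing R
  open RingProperties ring
    using (-1*x≈-x; +-inverseˡ-unique; -‿distribˡ-*; -‿involutive; -‿+-comm)
  open CommutativeSemigroupProperties *-commutativeSemigroup using (interchange)
  open Sum semiring
  open Mult semiring using (_×_; ×-congʳ; ×-homo-+; ×-assoc-*; ×-comm-*)
  open CommutativeMonoidMult +-commutativeMonoid using (×-distrib-+)
  open CommutativeExp commutativeSemiring using (_^_; ^-congˡ; ^-homo-*; ^-distrib-*)
  open PowerSeries R
  open SetoidReasoning setoid
  private
    module S = CommutativeRing commutativeRing
    module SR = SetoidReasoning S.setoid
  open CommutativeSemigroupProperties S.*-commutativeSemigroup using ()
    renaming (x∙yz≈y∙xz to f∙gh≈g∙fh)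
  open Mult S.semiring using ()
    renaming (_×_ to _×ˢ_; ×-congʳ to ×ˢ-congʳ; ×-comm-* to ×ˢ-comm-*)
  open Exp S.semiring using () renaming (_^_ to _^ˢ_)

  ×-zeroʳ : ∀ n → n × 0# ≈ 0#
  ×-zeroʳ zero    = refl
  ×-zeroʳ (suc n) = trans (+-identityˡ _) (×-zeroʳ n)

  sum-truncate : ∀ {m n} → m ≤ n → (f : Series) → (∀ i → m < i → f i ≈ 0#) →
                 ∑[ i ≤ n ] f (toℕ i) ≈ ∑[ i ≤ m ] f (toℕ i)
  sum-truncate {n = n} z≤n f f≈0 = trans
    (sum-single n 0 f z≤n λ where
      zero    _ 0≢0 → contradiction ≡.refl 0≢0
      (suc i) _ _   → f≈0 (suc i) (s≤s z≤n))
    (sym (+-identityʳ (f 0)))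
  sum-truncate (s≤s m≤n) f f≈0 = +-congˡ (sum-truncate m≤n (f ∘ suc) λ i m<i → f≈0 (suc i) (s≤s m<i))

  ×-distrib-sum : ∀ k n (f : Fin n → Carrier) → k × ∑[ i < n ] f i ≈ ∑[ i < n ] (k × f i)
  ×-distrib-sum k zero    f = ×-zeroʳ k
  ×-distrib-sum k (suc n) f = trans
    (×-distrib-+ _ _ k) (+-congˡ (×-distrib-sum k n (f ∘ Fin.suc)))

  ⊛-distribˡ-sum : ∀ g N (h : ℕ → Series) n →
    (g ⊛ (λ m → ∑[ k ≤ N ] h (toℕ k) m)) n ≈ ∑[ k ≤ N ] (g ⊛ h (toℕ k)) n
  ⊛-distribˡ-sum g N h n = trans
    (sum-cong-≋ λ (i : Fin (suc n)) → *-distribˡ-sum {suc N} (g (toℕ i)) λ k → h (toℕ k) (n ∸ toℕ i))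
    (∑-comm {suc n} {suc N} λ i k → g (toℕ i) * h (toℕ k) (n ∸ toℕ i))

  -- The Euler operator u d/du; n × x is the n-fold sum of x.
  θ : Series → Series
  θ f n = n × f n

  θ-cong : ∀ {f g} → f ≋ g → θ f ≋ θ g
  θ-cong f≋g n = ×-congʳ n (f≋g n)

  θ-const : ∀ a → θ (const a) ≋ const 0#
  θ-const a zero    = refl
  θ-const a (suc n) = ×-zeroʳ (suc n)

  -- Weighting the nth coefficient of a product splits along n = i + (n ∸ i).
  θ-⊛ : ∀ f g → θ (f ⊛ g) ≋ (θ f ⊛ g) ⊕ (f ⊛ θ g)
  θ-⊛ f g n = begin
    n × ∑[ i ≤ n ] (f (toℕ i) * g (n ∸ toℕ i))
      ≈⟨ ×-distrib-sum n (suc n) (λ i → f (toℕ i) * g (n ∸ toℕ i)) ⟩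
    ∑[ i ≤ n ] (n × (f (toℕ i) * g (n ∸ toℕ i)))
      ≈⟨ sum-cong-≋ {suc n} (λ i → term (toℕ i) (ℕ.s≤s⁻¹ (Fin.toℕ<n i))) ⟩
    ∑[ i ≤ n ] (θ f (toℕ i) * g (n ∸ toℕ i) + f (toℕ i) * θ g (n ∸ toℕ i))
      ≈⟨ ∑-distrib-+ {suc n} (λ i → θ f (toℕ i) * g (n ∸ toℕ i)) (λ i → f (toℕ i) * θ g (n ∸ toℕ i)) ⟩
    (θ f ⊛ g) n + (f ⊛ θ g) n ∎
    where
    term : ∀ i → i ≤ n → n × (f i * g (n ∸ i)) ≈ θ f i * g (n ∸ i) + f i * θ g (n ∸ i)
    term i i≤n = begin
      n × (f i * g (n ∸ i))
        ≡⟨ ≡.cong (_× (f i * g (n ∸ i))) (ℕ.m+[n∸m]≡n i≤n) ⟨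
      (i ℕ.+ (n ∸ i)) × (f i * g (n ∸ i))
        ≈⟨ ×-homo-+ _ i (n ∸ i) ⟩
      i × (f i * g (n ∸ i)) + (n ∸ i) × (f i * g (n ∸ i))
        ≈⟨ +-cong (×-assoc-* i (f i) _) (×-comm-* (n ∸ i) (f i) _) ⟨
      θ f i * g (n ∸ i) + f i * θ g (n ∸ i) ∎

  ×ˢ-coefficient : ∀ k f n → (k ×ˢ f) n ≈ k × f n
  ×ˢ-coefficient zero    f zero    = refl
  ×ˢ-coefficient zero    f (suc n) = refl
  ×ˢ-coefficient (suc k) f n       = +-congˡ (×ˢ-coefficient k f n)

  θ-^ : ∀ A k → θ (A ^ˢ suc k) ≋ suc k ×ˢ (θ A ⊛ A ^ˢ k)
  θ-^ A k = SR.begin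
    θ (A ⊛ A ^ˢ k)                       SR.≈⟨ θ-⊛ A (A ^ˢ k) ⟩
    (θ A ⊛ A ^ˢ k) ⊕ (A ⊛ θ (A ^ˢ k))    SR.≈⟨ S.+-congˡ {θ A ⊛ A ^ˢ k} (rest k) ⟩
    suc k ×ˢ (θ A ⊛ A ^ˢ k)              SR.∎
    where
    rest : ∀ k → A ⊛ θ (A ^ˢ k) ≋ k ×ˢ (θ A ⊛ A ^ˢ k)
    rest zero    = S.trans (S.*-congˡ {A} (θ-const 1#)) (S.zeroʳ A)
    rest (suc k) = SR.begin
      A ⊛ θ (A ^ˢ suc k)                 SR.≈⟨ S.*-congˡ {A} (θ-^ A k) ⟩
      A ⊛ (suc k ×ˢ (θ A ⊛ A ^ˢ k))      SR.≈⟨ ×ˢ-comm-* (suc k) A (θ A ⊛ A ^ˢ k) ⟩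
      suc k ×ˢ (A ⊛ (θ A ⊛ A ^ˢ k))      SR.≈⟨ ×ˢ-congʳ (suc k) (f∙gh≈g∙fh A (θ A) (A ^ˢ k)) ⟩
      suc k ×ˢ (θ A ⊛ A ^ˢ suc k)        SR.∎

  -- f(-u).
  reflect : Series → Series
  reflect f n = (- 1#) ^ n * f n

  reflect-cong : ∀ {f g} → f ≋ g → reflect f ≋ reflect g
  reflect-cong f≋g n = *-congˡ (f≋g n)

  reflect-⊛ : ∀ f g → reflect (f ⊛ g) ≋ reflect f ⊛ reflect g
  reflect-⊛ f g n = begin
    (- 1#) ^ n * ∑[ i ≤ n ] (f (toℕ i) * g (n ∸ toℕ i))
      ≈⟨ *-distribˡ-sum {suc n} ((- 1#) ^ n) (λ i → f (toℕ i) * g (n ∸ toℕ i)) ⟩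
    ∑[ i ≤ n ] ((- 1#) ^ n * (f (toℕ i) * g (n ∸ toℕ i)))
      ≈⟨ sum-cong-≋ {suc n} (λ i → term (toℕ i) (ℕ.s≤s⁻¹ (Fin.toℕ<n i))) ⟩
    (reflect f ⊛ reflect g) n ∎
    where
    term : ∀ i → i ≤ n → (- 1#) ^ n * (f i * g (n ∸ i)) ≈ reflect f i * reflect g (n ∸ i)
    term i i≤n = begin
      (- 1#) ^ n * (f i * g (n ∸ i))
        ≡⟨ ≡.cong (λ k → (- 1#) ^ k * (f i * g (n ∸ i))) (ℕ.m+[n∸m]≡n i≤n) ⟨
      (- 1#) ^ (i ℕ.+ (n ∸ i)) * (f i * g (n ∸ i))
        ≈⟨ *-congʳ (^-homo-* (- 1#) i (n ∸ i)) ⟩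
      ((- 1#) ^ i * (- 1#) ^ (n ∸ i)) * (f i * g (n ∸ i))
        ≈⟨ interchange _ _ _ _ ⟩
      reflect f i * reflect g (n ∸ i) ∎

  θ-reflect : ∀ f → θ (reflect f) ≋ reflect (θ f)
  θ-reflect f n = sym (×-comm-* n ((- 1#) ^ n) (f n))

  -- A linear equation θX = q X with q(0) = 0 reads n Xₙ = Σ_{i ≥ 1} qᵢ Xₙ₋ᵢ, so it
  -- determines X from its constant term as soon as n can be cancelled.
  module _ (×-cancel : ∀ n {x y} → suc n × x ≈ suc n × y → x ≈ y) where

    θ-unique : ∀ q X Y → q 0 ≈ 0# → X 0 ≈ Y 0 →
               θ X ≋ q ⊛ X → θ Y ≋ q ⊛ Y → X ≋ Y
    θ-unique q X Y q₀≈0 X₀≈Y₀ θX θY n = upTo n n ℕ.≤-refl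
      where
      peel : ∀ Z n → (q ⊛ Z) (suc n) ≈ ((q ∘ suc) ⊛ Z) n
      peel Z n = trans (+-congʳ (trans (*-congʳ q₀≈0) (zeroˡ _))) (+-identityˡ _)

      upTo : ∀ n i → i ≤ n → X i ≈ Y i
      upTo n       zero    _         = X₀≈Y₀
      upTo (suc n) (suc i) (s≤s i≤n) = ×-cancel i (begin
        suc i × X (suc i)    ≈⟨ θX (suc i) ⟩
        (q ⊛ X) (suc i)      ≈⟨ peel X i ⟩
        ((q ∘ suc) ⊛ X) i    ≈⟨ sum-cong-≋ {suc i} (λ j →
                                  *-congˡ {q (suc (toℕ j))}
                                    (upTo n (i ∸ toℕ j) (ℕ.≤-trans (ℕ.m∸n≤m i (toℕ j)) i≤n))) ⟩
        ((q ∘ suc) ⊛ Y) i    ≈⟨ peel Y i ⟨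
        (q ⊛ Y) (suc i)      ≈⟨ θY (suc i) ⟨
        suc i × Y (suc i)    ∎)

    -- Both E X and E(-u) solve θY = p(-u) Y: the former because θ(E X) = (p + b) E X.
    ⊛-reflect : ∀ p b E X → θ E ≋ p ⊛ E → θ X ≋ b ⊛ X → p ⊕ b ≋ reflect p →
                p 0 ≈ 0# → X 0 ≈ 1# → E ⊛ X ≋ reflect E
    ⊛-reflect p b E X θE θX p⊕b p₀≈0 X₀≈1 = θ-unique (reflect p) (E ⊛ X) (reflect E)
      (trans (*-congˡ p₀≈0) (zeroʳ _))
      (trans (+-identityʳ _) (trans (*-congˡ X₀≈1) (*-comm (E 0) 1#)))
      (SR.begin
        θ (E ⊛ X)                            SR.≈⟨ θ-⊛ E X ⟩
        (θ E ⊛ X) ⊕ (E ⊛ θ X)                SR.≈⟨ S.+-cong (S.*-congʳ {X} θE) (S.*-congˡ {E} θX) ⟩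
        ((p ⊛ E) ⊛ X) ⊕ (E ⊛ (b ⊛ X))        SR.≈⟨ S.+-cong (S.*-assoc p E X) (f∙gh≈g∙fh E b X) ⟩
        (p ⊛ (E ⊛ X)) ⊕ (b ⊛ (E ⊛ X))        SR.≈⟨ S.distribʳ (E ⊛ X) p b ⟨
        (p ⊕ b) ⊛ (E ⊛ X)                    SR.≈⟨ S.*-congʳ {E ⊛ X} p⊕b ⟩
        reflect p ⊛ (E ⊛ X)                  SR.∎)
      (SR.begin
        θ (reflect E)                        SR.≈⟨ θ-reflect E ⟩
        reflect (θ E)                        SR.≈⟨ reflect-cong θE ⟩
        reflect (p ⊛ E)                      SR.≈⟨ reflect-⊛ p E ⟩
        reflect p ⊛ reflect E                SR.∎)

  -- Elementary symmetric polynomials and their generating function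

  -- 1 + xu.
  linear : Carrier → Series
  linear x zero          = 1#
  linear x (suc zero)    = x
  linear x (suc (suc n)) = 0#

  linear-⊛ : ∀ x g n → (linear x ⊛ g) (suc n) ≈ g (suc n) + x * g n
  linear-⊛ x g n = +-cong (*-identityˡ _) (sum-single n 0 (λ i → linear x (suc i) * g (n ∸ i)) z≤n
    λ { zero _ 0≢0 → contradiction ≡.refl 0≢0 ; (suc i) _ _ → zeroˡ _ })

  open Symmetric R using (elementary)

  -- The generating function Σ eₖ uᵏ; it is the product of the factors 1 + xu
  -- by elementarySeries-∷.
  elementarySeries : List Carrier → Series
  elementarySeries xs k = elementary k xs

  private
    -- The sum and the product of a list.
    sumL prodL : List Carrier → Carrier
    sumL  = List.foldr _+_ 0#
    prodL = List.foldr _*_ 1#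

  sumL-++ : ∀ xs ys → sumL (xs ++ ys) ≈ sumL xs + sumL ys
  sumL-++ []       ys = sym (+-identityˡ _)
  sumL-++ (x ∷ xs) ys = trans (+-congˡ (sumL-++ xs ys)) (sym (+-assoc _ _ _))

  elementary-zero : ∀ xs → elementary 0 xs ≈ 1#
  elementary-zero xs = +-identityʳ 1#

  elementary-∷ : ∀ k x xs → elementary (suc k) (x ∷ xs) ≈ x * elementary k xs + elementary (suc k) xs
  elementary-∷ k x xs = begin
    sumL (List.map prodL (List.map (x ∷_) (choose k xs) ++ choose (suc k) xs))
      ≡⟨ ≡.cong sumL (map-++ prodL (List.map (x ∷_) (choose k xs)) (choose (suc k) xs)) ⟩
    sumL (List.map prodL (List.map (x ∷_) (choose k xs)) ++ List.map prodL (choose (suc k) xs))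
      ≈⟨ sumL-++ (List.map prodL (List.map (x ∷_) (choose k xs))) _ ⟩
    sumL (List.map prodL (List.map (x ∷_) (choose k xs))) + elementary (suc k) xs
      ≈⟨ +-congʳ (factor (choose k xs)) ⟩
    x * elementary k xs + elementary (suc k) xs ∎
    where
    factor : ∀ yss → sumL (List.map prodL (List.map (x ∷_) yss)) ≈ x * sumL (List.map prodL yss)
    factor []         = sym (zeroʳ x)
    factor (ys ∷ yss) = trans (+-congˡ (factor yss)) (sym (distribˡ x _ _))

  elementary-vanishes : ∀ k xs → List.length xs < k → elementary k xs ≈ 0#
  elementary-vanishes (suc k) []       _         = refl
  elementary-vanishes (suc k) (x ∷ xs) (s≤s l<k) = begin
    elementary (suc k) (x ∷ xs)
      ≈⟨ elementary-∷ k x xs ⟩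
    x * elementary k xs + elementary (suc k) xs
      ≈⟨ +-cong (trans (*-congˡ (elementary-vanishes k xs l<k)) (zeroʳ x))
                (elementary-vanishes (suc k) xs (ℕ.m<n⇒m<1+n l<k)) ⟩
    0# + 0#
      ≈⟨ +-identityˡ 0# ⟩
    0# ∎

  elementarySeries-∷ : ∀ x xs → elementarySeries (x ∷ xs) ≋ linear x ⊛ elementarySeries xs
  elementarySeries-∷ x xs zero    = sym (trans (+-identityʳ _) (*-identityˡ _))
  elementarySeries-∷ x xs (suc k) = begin
    elementary (suc k) (x ∷ xs)                  ≈⟨ elementary-∷ k x xs ⟩
    x * elementary k xs + elementary (suc k) xs  ≈⟨ +-comm _ _ ⟩
    elementary (suc k) xs + x * elementary k xs  ≈⟨ linear-⊛ x (elementarySeries xs) k ⟨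
    (linear x ⊛ elementarySeries xs) (suc k)     ∎

  -- xu/(1 + xu), expanded: the logarithmic derivative θL/L of L = 1 + xu.
  linearLogDeriv : Carrier → Series
  linearLogDeriv x zero    = 0#
  linearLogDeriv x (suc n) = x * (- x) ^ n

  -- Σ xu/(1 + xu) over the elements x of the list.
  logDeriv : List Carrier → Series
  logDeriv = List.foldr (λ x p → linearLogDeriv x ⊕ p) (const 0#)

  logDeriv-zero : ∀ xs → logDeriv xs 0 ≈ 0#
  logDeriv-zero []       = refl
  logDeriv-zero (x ∷ xs) = trans (+-identityˡ _) (logDeriv-zero xs)

  θ-linear : ∀ x → θ (linear x) ≋ linearLogDeriv x ⊛ linear x
  θ-linear x n = trans (compare n) (S.*-comm (linear x) (linearLogDeriv x) n)
    where
    compare : ∀ n → θ (linear x) n ≈ (linear x ⊛ linearLogDeriv x) n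
    compare zero          = sym (trans (+-identityʳ _) (zeroʳ _))
    compare (suc zero)    = begin
      x + 0#                                       ≈⟨ +-cong (*-identityʳ x) (zeroʳ x) ⟨
      x * 1# + x * 0#                              ≈⟨ linear-⊛ x (linearLogDeriv x) 0 ⟨
      (linear x ⊛ linearLogDeriv x) 1              ∎
    compare (suc (suc n)) = begin
      suc (suc n) × 0#                             ≈⟨ ×-zeroʳ (suc (suc n)) ⟩
      0#                                           ≈⟨ zeroʳ x ⟨
      x * 0#                                       ≈⟨ *-congˡ (trans (+-congʳ (sym (-‿distribˡ-* x _))) (-‿inverseˡ _)) ⟨
      x * (- x * (- x) ^ n + x * (- x) ^ n)        ≈⟨ distribˡ x _ _ ⟩
      x * (- x) ^ suc n + x * (x * (- x) ^ n)      ≈⟨ linear-⊛ x (linearLogDeriv x) (suc n) ⟨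
      (linear x ⊛ linearLogDeriv x) (suc (suc n))  ∎

  θ-elementarySeries : ∀ xs → θ (elementarySeries xs) ≋ logDeriv xs ⊛ elementarySeries xs
  θ-elementarySeries [] = SR.begin
    θ (elementarySeries [])            SR.≈⟨ θ-cong elementarySeries-[] ⟩
    θ (const 1#)                       SR.≈⟨ θ-const 1# ⟩
    const 0#                           SR.≈⟨ S.zeroˡ (elementarySeries []) ⟨
    const 0# ⊛ elementarySeries []     SR.∎
    where
    elementarySeries-[] : elementarySeries [] ≋ const 1#
    elementarySeries-[] zero    = +-identityʳ 1#
    elementarySeries-[] (suc k) = refl
  θ-elementarySeries (x ∷ xs) = SR.begin
    θ (elementarySeries (x ∷ xs))                  SR.≈⟨ θ-cong (elementarySeries-∷ x xs) ⟩
    θ (L ⊛ E)                                      SR.≈⟨ θ-⊛ L E ⟩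
    (θ L ⊛ E) ⊕ (L ⊛ θ E)                          SR.≈⟨ S.+-cong (S.*-congʳ {E} (θ-linear x))
                                                                  (S.*-congˡ {L} (θ-elementarySeries xs)) ⟩
    ((q ⊛ L) ⊛ E) ⊕ (L ⊛ (p ⊛ E))                  SR.≈⟨ S.+-cong (S.*-assoc q L E) (f∙gh≈g∙fh L p E) ⟩
    (q ⊛ (L ⊛ E)) ⊕ (p ⊛ (L ⊛ E))                  SR.≈⟨ S.distribʳ (L ⊛ E) q p ⟨
    (q ⊕ p) ⊛ (L ⊛ E)                              SR.≈⟨ S.*-congˡ {q ⊕ p} (elementarySeries-∷ x xs) ⟨
    logDeriv (x ∷ xs) ⊛ elementarySeries (x ∷ xs)  SR.∎
    where
    L E p q : Series
    L = linear x
    E = elementarySeries xs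
    p = logDeriv xs
    q = linearLogDeriv x

  -- Σ xⁿ over the elements x of the list.
  powerSum : ℕ → List Carrier → Carrier
  powerSum n xs = sumL (List.map (_^ n) xs)

  -1^even : ∀ n → parity n ≡ 0ℙ → (- 1#) ^ n ≈ 1#
  -1^even zero          _    = refl
  -1^even (suc (suc n)) even = begin
    - 1# * (- 1# * (- 1#) ^ n)  ≈⟨ trans (-1*x≈-x _) (-‿cong (-1*x≈-x _)) ⟩
    - - ((- 1#) ^ n)            ≈⟨ -‿involutive _ ⟩
    (- 1#) ^ n                  ≈⟨ -1^even n even ⟩
    1#                          ∎

  odd⇒even : ∀ n → parity (suc n) ≡ 1ℙ → parity n ≡ 0ℙ
  odd⇒even n odd = ≡.trans (≡.sym (suc-homo-⁻¹ n)) (≡.cong ℙ._⁻¹ odd)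

  -- The coefficient of uⁿ in xu/(1 + xu) is x(-x)ⁿ⁻¹, which is xⁿ for odd n.
  logDeriv-odd : ∀ n xs → parity (suc n) ≡ 1ℙ → logDeriv xs (suc n) ≈ powerSum (suc n) xs
  logDeriv-odd n []       odd = refl
  logDeriv-odd n (x ∷ xs) odd = +-cong (*-congˡ (begin
    (- x) ^ n            ≈⟨ ^-congˡ n (-1*x≈-x x) ⟨
    (- 1# * x) ^ n       ≈⟨ ^-distrib-* (- 1#) x n ⟩
    (- 1#) ^ n * x ^ n   ≈⟨ *-congʳ (-1^even n (odd⇒even n odd)) ⟩
    1# * x ^ n           ≈⟨ *-identityˡ _ ⟩
    x ^ n                ∎)) (logDeriv-odd n xs odd)

  -- Write p for logDeriv xs.  Then p(-u) - p vanishes in even degrees and has the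
  -- coefficient -2 Σ xⁿ in odd degrees n.
  logDeriv-⊕ : ∀ xs b → b 0 ≈ 0# →
    (∀ n → parity (suc n) ≡ 0ℙ → b (suc n) ≈ 0#) →
    (∀ n → parity (suc n) ≡ 1ℙ → b (suc n) ≈ - (powerSum (suc n) xs + powerSum (suc n) xs)) →
    logDeriv xs ⊕ b ≋ reflect (logDeriv xs)
  logDeriv-⊕ xs b b₀≈0 even odd zero = begin
    logDeriv xs 0 + b 0     ≈⟨ +-congˡ b₀≈0 ⟩
    logDeriv xs 0 + 0#      ≈⟨ +-identityʳ _ ⟩
    logDeriv xs 0           ≈⟨ *-identityˡ _ ⟨
    1# * logDeriv xs 0      ∎
  logDeriv-⊕ xs b b₀≈0 even odd (suc n) with parity (suc n) in parity-eq
  ... | 0ℙ = begin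
    p + b (suc n)           ≈⟨ +-congˡ (even n parity-eq) ⟩
    p + 0#                  ≈⟨ +-identityʳ p ⟩
    p                       ≈⟨ *-identityˡ p ⟨
    1# * p                  ≈⟨ *-congʳ (-1^even (suc n) parity-eq) ⟨
    (- 1#) ^ suc n * p      ∎
    where
    p = logDeriv xs (suc n)
  ... | 1ℙ = begin
    p + b (suc n)           ≈⟨ +-congˡ (odd n parity-eq) ⟩
    p - (s + s)             ≈⟨ +-congˡ (-‿cong (+-cong p≈s p≈s)) ⟨
    p - (p + p)             ≈⟨ +-congˡ (-‿+-comm p p) ⟨
    p + (- p - p)           ≈⟨ +-assoc _ _ _ ⟨
    p - p - p               ≈⟨ +-congʳ (-‿inverseʳ p) ⟩
    0# - p                  ≈⟨ +-identityˡ _ ⟩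
    - p                     ≈⟨ -1*x≈-x p ⟨
    - 1# * p                ≈⟨ *-congʳ (*-identityʳ (- 1#)) ⟨
    - 1# * 1# * p           ≈⟨ *-congʳ (*-congˡ (-1^even n (odd⇒even n parity-eq))) ⟨
    (- 1#) ^ suc n * p      ∎
    where
    p = logDeriv xs (suc n)
    s = powerSum (suc n) xs
    p≈s : p ≈ s
    p≈s = logDeriv-odd n xs parity-eq

  -- Coefficients of the identity g(u) X(u) = g(-u) for a polynomial g of degree at most M.
  module _ (g X : Series) (M : ℕ) (vanishes : ∀ k → M < k → g k ≈ 0#)
           (g⊛X : g ⊛ X ≋ reflect g) where

    convolution : ∀ m → ∑[ j ≤ M ⊓ m ] (g (toℕ j) * X (m ∸ toℕ j)) ≈ reflect g m
    convolution m = trans (truncated m) (g⊛X m)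
      where
      truncated : ∀ m → ∑[ j ≤ M ⊓ m ] (g (toℕ j) * X (m ∸ toℕ j)) ≈ (g ⊛ X) m
      truncated m with ℕ.≤-total m M
      ... | inj₁ m≤M rewrite ℕ.m≥n⇒m⊓n≡n m≤M = refl
      ... | inj₂ M≤m rewrite ℕ.m≤n⇒m⊓n≡m M≤m = sym (sum-truncate M≤m (λ j → g j * X (m ∸ j))
            λ j M<j → trans (*-congʳ (vanishes j M<j)) (zeroˡ _))

    convolution-vanishes : ∀ m → M < m → ∑[ j ≤ M ⊓ m ] (g (toℕ j) * X (m ∸ toℕ j)) ≈ 0#
    convolution-vanishes m M<m =
      trans (convolution m) (trans (*-congˡ (vanishes m M<m)) (zeroʳ _))

    recurrence : g 0 ≈ 1# → ∀ m → M < m →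
                 X m ≈ - ∑[ j < M ] (g (suc (toℕ j)) * X (m ∸ suc (toℕ j)))
    recurrence g₀≈1 m M<m = +-inverseˡ-unique _ _ (begin
      X m + ∑[ j < M ] (g (suc (toℕ j)) * X (m ∸ suc (toℕ j)))
        ≈⟨ +-congʳ (trans (*-congʳ g₀≈1) (*-identityˡ _)) ⟨
      ∑[ j ≤ M ] (g (toℕ j) * X (m ∸ toℕ j))
        ≡⟨ ≡.cong (λ k → ∑[ j ≤ k ] (g (toℕ j) * X (m ∸ toℕ j))) (ℕ.m≤n⇒m⊓n≡m (ℕ.<⇒≤ M<m)) ⟨
      ∑[ j ≤ M ⊓ m ] (g (toℕ j) * X (m ∸ toℕ j))
        ≈⟨ convolution-vanishes m M<m ⟩
      0# ∎)

-- Exponentials over a ℚ-algebra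

open Mult (CommutativeRing.semiring ℚ-ring) using () renaming (_×_ to _×ℚ_)

/-+ : ∀ p q d .{{_ : NonZero d}} → p / d ℚ.+ q / d ≡ (p ℤ.+ q) / d
/-+ p q (suc d) = ℚ.toℚᵘ-injective (begin
  toℚᵘ (p / suc d ℚ.+ q / suc d)
    ≈⟨ ℚ.toℚᵘ-homo-+ (p / suc d) (q / suc d) ⟩
  toℚᵘ (p / suc d) ℚᵘ.+ toℚᵘ (q / suc d)
    ≈⟨ ℚᵘ.+-cong (ℚ.toℚᵘ-fromℚᵘ (ℚᵘ.mkℚᵘ p d)) (ℚ.toℚᵘ-fromℚᵘ (ℚᵘ.mkℚᵘ q d)) ⟩
  ℚᵘ.mkℚᵘ p d ℚᵘ.+ ℚᵘ.mkℚᵘ q d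
    ≈⟨ ℚᵘ.*≡* commonDenominator ⟩
  ℚᵘ.mkℚᵘ (p ℤ.+ q) d
    ≈⟨ ℚ.toℚᵘ-fromℚᵘ (ℚᵘ.mkℚᵘ (p ℤ.+ q) d) ⟨
  toℚᵘ ((p ℤ.+ q) / suc d) ∎)
  where
  open SetoidReasoning ℚᵘ.≃-setoid
  commonDenominator : (p ℤ.* + suc d ℤ.+ q ℤ.* + suc d) ℤ.* + suc d ≡ (p ℤ.+ q) ℤ.* (+ suc d ℤ.* + suc d)
  commonDenominator = ≡.trans (≡.cong (ℤ._* + suc d) (≡.sym (ℤ.*-distribʳ-+ (+ suc d) p q)))
                              (ℤ.*-assoc (p ℤ.+ q) (+ suc d) (+ suc d))

×-/ : ∀ n p d .{{_ : NonZero d}} → n ×ℚ (p / d) ≡ (+ n ℤ.* p) / d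
×-/ zero    p (suc d) = ≡.sym (≡.trans (≡.cong (_/ suc d) (ℤ.*-zeroˡ p)) (ℚ.0/n≡0 (suc d)))
×-/ (suc n) p d = ≡.trans (≡.cong (p / d ℚ.+_) (×-/ n p d))
  (≡.trans (/-+ p (+ n ℤ.* p) d) (≡.cong (_/ d) (≡.sym (ℤ.suc-* (+ n) p))))

×-1/ : ∀ n d .{{_ : NonZero d}} .{{_ : NonZero (suc n ℕ.* d)}} → suc n ×ℚ (+ 1 / (suc n ℕ.* d)) ≡ + 1 / d
×-1/ n (suc d) = ≡.trans (×-/ (suc n) (+ 1) (suc n ℕ.* suc d))
  (ℚ.fromℚᵘ-cong (ℚᵘ.*-cancelˡ-/ (suc n) {+ 1} {suc d}))

-- A ℚ-algebra: a commutative ring R with a ring homomorphism ι from ℚ.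
module ℚ-Algebra {c ℓ} (R : CommutativeRing c ℓ) (ι : ℚ → CommutativeRing.Carrier R)
  (isHom : IsRingHomomorphism (CommutativeRing.rawRing ℚ-ring) (CommutativeRing.rawRing R) ι) where

  open CommutativeRing R
  open IsRingHomomorphism isHom
  open CommutativeMonoidMult +-commutativeMonoid using (×-distrib-+)
  open Exponential R ι using (exp; ^ˢ-order)
  open FormalSeries R
  open Mult semiring using (_×_; ×-congʳ; ×-assoc-*; ×-comm-*)
  open PowerSeries R
  open RingProperties ring using (-‿distribˡ-*)
  open SetoidReasoning setoid
  open Sum semiring using (sum⁺-syntax; sum-cong-≋)
  private
    module S = CommutativeRing commutativeRing
  open Exp S.semiring using () renaming (_^_ to _^ˢ_)

  ι-× : ∀ n q → ι (n ×ℚ q) ≈ n × ι q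
  ι-× zero    q = 0#-homo
  ι-× (suc n) q = trans (+-homo q (n ×ℚ q)) (+-congˡ (ι-× n q))

  ×-reciprocal : ∀ n → suc n × ι (+ 1 / suc n) ≈ 1#
  ×-reciprocal n = begin
    suc n × ι (+ 1 / suc n)       ≈⟨ ι-× (suc n) (+ 1 / suc n) ⟨
    ι (suc n ×ℚ (+ 1 / suc n))    ≡⟨ ≡.cong ι suc-n×1/suc-n ⟩
    ι 1ℚ                          ≈⟨ 1#-homo ⟩
    1#                            ∎
    where
    suc-n×1/suc-n : suc n ×ℚ (+ 1 / suc n) ≡ 1ℚ
    suc-n×1/suc-n = ≡.trans
      (≡.cong (suc n ×ℚ_) (ℚ./-cong {+ 1} {suc n} {+ 1} {suc n ℕ.* 1} ≡.refl (≡.sym (ℕ.*-identityʳ (suc n)))))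
      (×-1/ n 1)

  ×-cancel : ∀ n {x y} → suc n × x ≈ suc n × y → x ≈ y
  ×-cancel n {x} {y} eq = trans (divide x) (trans (*-congˡ eq) (sym (divide y)))
    where
    divide : ∀ z → z ≈ ι (+ 1 / suc n) * (suc n × z)
    divide z = begin
      z                                  ≈⟨ *-identityˡ z ⟨
      1# * z                             ≈⟨ *-congʳ (×-reciprocal n) ⟨
      suc n × ι (+ 1 / suc n) * z        ≈⟨ ×-assoc-* (suc n) _ z ⟩
      suc n × (ι (+ 1 / suc n) * z)      ≈⟨ ×-comm-* (suc n) _ z ⟨
      ι (+ 1 / suc n) * (suc n × z)      ∎

  -- The coefficients 1/k! of the exponential series.
  coefficient : ℕ → Carrier
  coefficient k = ι (_/_ (+ 1) (k !) {{ k ℕ.!≢0 }})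

  coefficient-suc : ∀ k → suc k × coefficient (suc k) ≈ coefficient k
  coefficient-suc k = begin
    suc k × coefficient (suc k)
      ≈⟨ ι-× (suc k) _ ⟨
    ι (suc k ×ℚ (_/_ (+ 1) (suc k !) {{ suc k ℕ.!≢0 }}))
      ≡⟨ ≡.cong ι (×-1/ k (k !) {{ k ℕ.!≢0 }} {{ suc k ℕ.!≢0 }}) ⟩
    coefficient k ∎

  -- Σ_{k ≤ N} Aᵏ/k!.
  partialSum : ℕ → Series → Series
  partialSum N A n = ∑[ k ≤ N ] (coefficient (toℕ k) * (A ^ˢ toℕ k) n)

  -- Aᵏ has no terms of degree below k, so terms with k > n do not affect degree n.
  partialSum≈exp : ∀ A → A 0 ≈ 0# → ∀ {N n} → n ≤ N → partialSum N A n ≈ exp A n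
  partialSum≈exp A A₀≈0 {n = n} n≤N = sum-truncate n≤N
    (λ k → coefficient k * (A ^ˢ k) n)
    (λ k n<k → trans (*-congˡ (^ˢ-order A A₀≈0 k n n<k)) (zeroʳ _))

  -- Differentiating Aᵏ⁺¹/(k+1)! gives θA Aᵏ/k!.
  θ-partialSum : ∀ N A → θ (partialSum (suc N) A) ≋ θ A ⊛ partialSum N A
  θ-partialSum N A n = begin
    n × partialSum (suc N) A n
      ≈⟨ ×-distrib-+ _ _ n ⟩
    n × (coefficient 0 * const 1# n)
      + n × ∑[ k ≤ N ] (coefficient (suc (toℕ k)) * (A ^ˢ suc (toℕ k)) n)
      ≈⟨ +-cong constantTerm
           (×-distrib-sum n (suc N) λ k → coefficient (suc (toℕ k)) * (A ^ˢ suc (toℕ k)) n) ⟩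
    0# + ∑[ k ≤ N ] (n × (coefficient (suc (toℕ k)) * (A ^ˢ suc (toℕ k)) n))
      ≈⟨ +-identityˡ _ ⟩
    ∑[ k ≤ N ] (n × (coefficient (suc (toℕ k)) * (A ^ˢ suc (toℕ k)) n))
      ≈⟨ sum-cong-≋ {suc N} (λ k → term (toℕ k)) ⟩
    ∑[ k ≤ N ] (θ A ⊛ (λ m → coefficient (toℕ k) * (A ^ˢ toℕ k) m)) n
      ≈⟨ ⊛-distribˡ-sum (θ A) N (λ k m → coefficient k * (A ^ˢ k) m) n ⟨
    (θ A ⊛ partialSum N A) n ∎
    where
    constantTerm : n × (coefficient 0 * const 1# n) ≈ 0#
    constantTerm = begin
      n × (coefficient 0 * const 1# n)  ≈⟨ ×-comm-* n (coefficient 0) (const 1# n) ⟨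
      coefficient 0 * (n × const 1# n)  ≈⟨ *-congˡ (θ-const 1# n) ⟩
      coefficient 0 * const 0# n        ≈⟨ *-congˡ (const-0# n) ⟩
      coefficient 0 * 0#                ≈⟨ zeroʳ _ ⟩
      0#                                ∎
      where
      const-0# : ∀ n → const 0# n ≈ 0#
      const-0# zero    = refl
      const-0# (suc n) = refl

    ⊛-scaleʳ : ∀ a f g → (f ⊛ (λ m → a * g m)) n ≈ a * (f ⊛ g) n
    ⊛-scaleʳ a f g = begin
      (f ⊛ (λ m → a * g m)) n   ≈⟨ S.*-comm f (λ m → a * g m) n ⟩
      ((λ m → a * g m) ⊛ f) n   ≈⟨ ⊛-scale a g f n ⟩
      a * (g ⊛ f) n             ≈⟨ *-congˡ (S.*-comm g f n) ⟩
      a * (f ⊛ g) n             ∎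

    term : ∀ k → n × (coefficient (suc k) * (A ^ˢ suc k) n)
                 ≈ (θ A ⊛ (λ m → coefficient k * (A ^ˢ k) m)) n
    term k = begin
      n × (coefficient (suc k) * (A ^ˢ suc k) n)
        ≈⟨ ×-comm-* n _ _ ⟨
      coefficient (suc k) * θ (A ^ˢ suc k) n
        ≈⟨ *-congˡ (trans (θ-^ A k n) (×ˢ-coefficient (suc k) (θ A ⊛ A ^ˢ k) n)) ⟩
      coefficient (suc k) * (suc k × (θ A ⊛ A ^ˢ k) n)
        ≈⟨ trans (×-comm-* (suc k) _ _) (sym (×-assoc-* (suc k) _ _)) ⟩
      (suc k × coefficient (suc k)) * (θ A ⊛ A ^ˢ k) n
        ≈⟨ *-congʳ (coefficient-suc k) ⟩
      coefficient k * (θ A ⊛ A ^ˢ k) n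
        ≈⟨ ⊛-scaleʳ (coefficient k) (θ A) (A ^ˢ k) ⟨
      (θ A ⊛ (λ m → coefficient k * (A ^ˢ k) m)) n ∎

  -- Applying θ to a partial sum loses one term, whence the sum up to k = n + 1 on the
  -- left; both lengths are enough in degree n.
  θ-exp : ∀ A → A 0 ≈ 0# → θ (exp A) ≋ θ A ⊛ exp A
  θ-exp A A₀≈0 n = begin
    n × exp A n                    ≈⟨ ×-congʳ n (partialSum≈exp A A₀≈0 (ℕ.n≤1+n n)) ⟨
    θ (partialSum (suc n) A) n     ≈⟨ θ-partialSum n A n ⟩
    (θ A ⊛ partialSum n A) n       ≈⟨ sum-cong-≋ {suc n} (λ i →
                                        *-congˡ {θ A (toℕ i)} (partialSum≈exp A A₀≈0 (ℕ.m∸n≤m n (toℕ i)))) ⟩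
    (θ A ⊛ exp A) n                ∎

  ι-[-2] : ∀ x → ι (-[1+ 1 ] / 1) * x ≈ - (x + x)
  ι-[-2] x = begin
    ι (ℚ.- (1ℚ ℚ.+ 1ℚ)) * x   ≈⟨ *-congʳ (trans (-‿homo _)
                                   (-‿cong (trans (+-homo 1ℚ 1ℚ) (+-cong 1#-homo 1#-homo)))) ⟩
    - (1# + 1#) * x           ≈⟨ -‿distribˡ-* _ x ⟨
    - ((1# + 1#) * x)         ≈⟨ -‿cong (trans (distribʳ x 1# 1#) (+-cong (*-identityˡ x) (*-identityˡ x))) ⟩
    - (x + x)                 ∎

  -- The shape of the odd coefficients -2 y/n of an exponent.
  ×-oddTerm : ∀ n y {z} → y ≈ z → suc n × (ι (-[1+ 1 ] / 1) * (y * ι (+ 1 / suc n))) ≈ - (z + z)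
  ×-oddTerm n y {z} y≈z = begin
    suc n × (ι (-[1+ 1 ] / 1) * (y * ι (+ 1 / suc n)))
      ≈⟨ ×-comm-* (suc n) _ _ ⟨
    ι (-[1+ 1 ] / 1) * (suc n × (y * ι (+ 1 / suc n)))
      ≈⟨ *-congˡ (×-comm-* (suc n) y _) ⟨
    ι (-[1+ 1 ] / 1) * (y * (suc n × ι (+ 1 / suc n)))
      ≈⟨ *-congˡ (trans (*-cong y≈z (×-reciprocal n)) (*-identityʳ z)) ⟩
    ι (-[1+ 1 ] / 1) * z
      ≈⟨ ι-[-2] z ⟩
    - (z + z) ∎

  -- If A = -2 Σ_{n odd} (Σ xⁿ) uⁿ/n over the elements x of the list, then
  -- exp A = E(-u)/E(u); the hypotheses describe θA rather than A.
  -- The series g and X are only required to agree with E and exp A coefficientwise,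
  -- so that they can be instantiated by sequences defined by other means.
  elementary-⊛-exp : ∀ xs A g X → g ≗ elementarySeries xs → X ≗ exp A → A 0 ≈ 0# →
    (∀ n → parity (suc n) ≡ 0ℙ → suc n × A (suc n) ≈ 0#) →
    (∀ n → parity (suc n) ≡ 1ℙ → suc n × A (suc n) ≈ - (powerSum (suc n) xs + powerSum (suc n) xs)) →
    g ⊛ X ≋ reflect g
  elementary-⊛-exp xs A g X g≗E X≗exp A₀≈0 even odd =
    ⊛-reflect ×-cancel (logDeriv xs) (θ A) g X
      (S.trans {θ g} (θ-cong g≋E)
        (S.trans (θ-elementarySeries xs) (S.*-congˡ {logDeriv xs} (S.sym {g} g≋E))))
      (S.trans {θ X} (θ-cong X≋exp)
        (S.trans (θ-exp A A₀≈0) (S.*-congˡ {θ A} (S.sym {X} X≋exp))))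
      (logDeriv-⊕ xs (θ A) refl even odd) (logDeriv-zero xs)
      (trans (X≋exp 0) (trans (+-identityʳ _) (trans (*-identityʳ _) 1#-homo)))
    where
    g≋E : g ≋ elementarySeries xs
    g≋E n = reflexive (g≗E n)

    X≋exp : X ≋ exp A
    X≋exp n = reflexive (X≗exp n)

-- Gaussian binomial coefficients

module GaussianBinomials {c ℓ} (R : CommutativeRing c ℓ) where

  open CommutativeRing R
  open CommutativeExp commutativeSemiring using (_^_; ^-congˡ; ^-homo-*; ^-distrib-*)
  open CommutativeSemigroupProperties *-commutativeSemigroup using (interchange; x∙yz≈y∙xz; xy∙z≈xz∙y)
  open FormalSeries R using (powerSum; elementary-∷; elementary-zero)
  open MonoidSum *-monoid using () renaming (sum to product)
  open RingProperties ring using (x[y-z]≈xy-xz)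
  open SetoidReasoning setoid
  open Symmetric R using (elementary)

  telescope : ∀ x y → (1# - x) + x * (1# - y) ≈ 1# - x * y
  telescope x y = begin
    (1# - x) + x * (1# - y)     ≈⟨ +-congˡ (trans (x[y-z]≈xy-xz x 1# y) (+-congʳ (*-identityʳ x))) ⟩
    (1# - x) + (x - x * y)      ≈⟨ +-assoc _ _ _ ⟩
    1# + (- x + (x - x * y))    ≈⟨ +-congˡ (+-assoc _ _ _) ⟨
    1# + (- x + x - x * y)      ≈⟨ +-congˡ (trans (+-congʳ (-‿inverseˡ x)) (+-identityˡ _)) ⟩
    1# - x * y                  ∎

  -- The base t, with inv n standing for 1/(1 - tⁿ⁺¹).
  module Base (t : Carrier) (inv : ℕ → Carrier)
    (inverseʳ : ∀ n → (1# - t ^ suc n) * inv n ≈ 1#) where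

    inverse-cancelʳ : ∀ n x → x * inv n * (1# - t ^ suc n) ≈ x
    inverse-cancelʳ n x = begin
      x * inv n * (1# - t ^ suc n)    ≈⟨ *-assoc _ _ _ ⟩
      x * (inv n * (1# - t ^ suc n))  ≈⟨ *-congˡ (trans (*-comm _ _) (inverseʳ n)) ⟩
      x * 1#                          ≈⟨ *-identityʳ x ⟩
      x                               ∎

    *-cancelʳ : ∀ n {x y} → x * (1# - t ^ suc n) ≈ y * (1# - t ^ suc n) → x ≈ y
    *-cancelʳ n {x} {y} eq = begin
      x                               ≈⟨ expand x ⟩
      x * (1# - t ^ suc n) * inv n    ≈⟨ *-congʳ eq ⟩
      y * (1# - t ^ suc n) * inv n    ≈⟨ expand y ⟨
      y                               ∎
      where
      expand : ∀ z → z ≈ z * (1# - t ^ suc n) * inv n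
      expand z = sym (trans (*-assoc _ _ _) (trans (*-congˡ (inverseʳ n)) (*-identityʳ z)))

    -- ∏_{i < k} (1 - tⁿ⁻ⁱ)/(1 - tⁱ⁺¹), which is zero for k > n.
    gaussian : ℕ → ℕ → Carrier
    gaussian n k = product {k} (λ i → (1# - t ^ (n ∸ toℕ i)) * inv (toℕ i))

    gaussian-suc : ∀ n k → gaussian n (suc k) ≈ gaussian n k * ((1# - t ^ (n ∸ k)) * inv k)
    gaussian-suc n k = product-last k λ i → (1# - t ^ (n ∸ i)) * inv i
      where
      product-last : ∀ k (f : ℕ → Carrier) →
                     product {suc k} (λ i → f (toℕ i)) ≈ product {k} (λ i → f (toℕ i)) * f k
      product-last zero    f = *-comm _ _
      product-last (suc k) f = trans (*-congˡ (product-last k λ i → f (suc i))) (sym (*-assoc _ _ _))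

    gaussian-suc-* : ∀ n k → gaussian n (suc k) * (1# - t ^ suc k) ≈ gaussian n k * (1# - t ^ (n ∸ k))
    gaussian-suc-* n k = trans (*-congʳ (trans (gaussian-suc n k) (sym (*-assoc _ _ _)))) (inverse-cancelʳ k _)

    -- [n+1, k+1] (1 - tᵏ⁺¹) = [n, k] (1 - tⁿ⁺¹).
    absorption : ∀ n k → gaussian (suc n) (suc k) * (1# - t ^ suc k) ≈ gaussian n k * (1# - t ^ suc n)
    absorption n zero = begin
      (1# - t ^ suc n) * inv 0 * 1# * (1# - t ^ 1)  ≈⟨ *-congʳ (*-identityʳ _) ⟩
      (1# - t ^ suc n) * inv 0 * (1# - t ^ 1)       ≈⟨ inverse-cancelʳ 0 _ ⟩
      1# - t ^ suc n                                ≈⟨ *-identityˡ _ ⟨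
      1# * (1# - t ^ suc n)                         ∎
    absorption n (suc k) = begin
      gaussian (suc n) (suc (suc k)) * (1# - t ^ suc (suc k))
        ≈⟨ *-congʳ (trans (gaussian-suc (suc n) (suc k)) (sym (*-assoc _ _ _))) ⟩
      gaussian (suc n) (suc k) * (1# - t ^ (n ∸ k)) * inv (suc k) * (1# - t ^ suc (suc k))
        ≈⟨ inverse-cancelʳ (suc k) _ ⟩
      gaussian (suc n) (suc k) * (1# - t ^ (n ∸ k))
        ≈⟨ *-cancelʳ k (begin
          gaussian (suc n) (suc k) * (1# - t ^ (n ∸ k)) * (1# - t ^ suc k)
            ≈⟨ xy∙z≈xz∙y _ _ _ ⟩
          gaussian (suc n) (suc k) * (1# - t ^ suc k) * (1# - t ^ (n ∸ k))
            ≈⟨ *-congʳ (absorption n k) ⟩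
          gaussian n k * (1# - t ^ suc n) * (1# - t ^ (n ∸ k))
            ≈⟨ xy∙z≈xz∙y _ _ _ ⟩
          gaussian n k * (1# - t ^ (n ∸ k)) * (1# - t ^ suc n)
            ≈⟨ *-congʳ (gaussian-suc-* n k) ⟨
          gaussian n (suc k) * (1# - t ^ suc k) * (1# - t ^ suc n)
            ≈⟨ xy∙z≈xz∙y _ _ _ ⟩
          gaussian n (suc k) * (1# - t ^ suc n) * (1# - t ^ suc k) ∎) ⟩
      gaussian n (suc k) * (1# - t ^ suc n) ∎

    gaussian-vanishes : ∀ n k → n < k → gaussian n k ≈ 0#
    gaussian-vanishes zero    (suc k) _         = trans
      (*-congʳ (trans (*-congʳ (-‿inverseʳ 1#)) (zeroˡ _))) (zeroˡ _)
    gaussian-vanishes (suc n) (suc k) (s≤s n<k) = *-cancelʳ k (begin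
      gaussian (suc n) (suc k) * (1# - t ^ suc k)  ≈⟨ absorption n k ⟩
      gaussian n k * (1# - t ^ suc n)              ≈⟨ *-congʳ (gaussian-vanishes n k n<k) ⟩
      0# * (1# - t ^ suc n)                        ≈⟨ trans (zeroˡ _) (sym (zeroˡ _)) ⟩
      0# * (1# - t ^ suc k)                        ∎)

    -- Valid for all n and k: for k > n both Gaussian binomials on the right vanish.
    pascal : ∀ n k → gaussian (suc n) (suc k) ≈ gaussian n k + t ^ suc k * gaussian n (suc k)
    pascal n k = *-cancelʳ k (begin
      gaussian (suc n) (suc k) * (1# - T)
        ≈⟨ absorption n k ⟩
      g * (1# - t ^ suc n)
        ≈⟨ numerator ⟩
      g * ((1# - T) + T * (1# - t ^ (n ∸ k)))
        ≈⟨ distribˡ g _ _ ⟩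
      g * (1# - T) + g * (T * (1# - t ^ (n ∸ k)))
        ≈⟨ +-congˡ (x∙yz≈y∙xz _ _ _) ⟩
      g * (1# - T) + T * (g * (1# - t ^ (n ∸ k)))
        ≈⟨ +-congˡ (*-congˡ (gaussian-suc-* n k)) ⟨
      g * (1# - T) + T * (gaussian n (suc k) * (1# - T))
        ≈⟨ +-congˡ (*-assoc _ _ _) ⟨
      g * (1# - T) + T * gaussian n (suc k) * (1# - T)
        ≈⟨ distribʳ _ _ _ ⟨
      (g + T * gaussian n (suc k)) * (1# - T) ∎)
      where
      T g : Carrier
      T = t ^ suc k
      g = gaussian n k

      numerator : g * (1# - t ^ suc n) ≈ g * ((1# - T) + T * (1# - t ^ (n ∸ k)))
      numerator with k ℕ.≤? n
      ... | yes k≤n = *-congˡ (begin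
        1# - t ^ suc n                       ≡⟨ ≡.cong (λ m → 1# - t ^ suc m) (ℕ.m+[n∸m]≡n k≤n) ⟨
        1# - t ^ (suc k ℕ.+ (n ∸ k))         ≈⟨ +-congˡ (-‿cong (^-homo-* t (suc k) (n ∸ k))) ⟩
        1# - T * t ^ (n ∸ k)                 ≈⟨ telescope T (t ^ (n ∸ k)) ⟨
        (1# - T) + T * (1# - t ^ (n ∸ k))    ∎)
      ... | no  k≰n = trans (vanish _) (sym (vanish _))
        where
        vanish : ∀ x → g * x ≈ 0#
        vanish x = trans (*-congʳ (gaussian-vanishes n k (ℕ.≰⇒> k≰n))) (zeroˡ x)

    -- 1, t, …, t^{M-1}.
    powers : ℕ → List Carrier
    powers = applyUpTo (t ^_)

    -- Shifting a geometric progression by one place multiplies every element by t,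
    -- hence eₖ by tᵏ.
    elementary-applyUpTo-suc : ∀ M k (f : ℕ → Carrier) → (∀ i → f (suc i) ≈ t * f i) →
      elementary k (applyUpTo (λ i → f (suc i)) M) ≈ t ^ k * elementary k (applyUpTo f M)
    elementary-applyUpTo-suc M       zero    f step = sym (*-identityˡ _)
    elementary-applyUpTo-suc zero    (suc k) f step = sym (zeroʳ _)
    elementary-applyUpTo-suc (suc M) (suc k) f step = begin
      elementary (suc k) (f 1 ∷ xs″)
        ≈⟨ elementary-∷ k (f 1) xs″ ⟩
      f 1 * elementary k xs″ + elementary (suc k) xs″
        ≈⟨ +-cong (*-cong (step 0) (elementary-applyUpTo-suc M k f′ step′))
                  (elementary-applyUpTo-suc M (suc k) f′ step′) ⟩
      t * f 0 * (t ^ k * elementary k xs′) + t ^ suc k * elementary (suc k) xs′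
        ≈⟨ +-congʳ (interchange _ _ _ _) ⟩
      t ^ suc k * (f 0 * elementary k xs′) + t ^ suc k * elementary (suc k) xs′
        ≈⟨ distribˡ _ _ _ ⟨
      t ^ suc k * (f 0 * elementary k xs′ + elementary (suc k) xs′)
        ≈⟨ *-congˡ (elementary-∷ k (f 0) xs′) ⟨
      t ^ suc k * elementary (suc k) (f 0 ∷ xs′) ∎
      where
      f′ = λ i → f (suc i)
      step′ = λ i → step (suc i)
      xs′ = applyUpTo f′ M
      xs″ = applyUpTo (λ i → f′ (suc i)) M

    elementary-powers : ∀ M k → elementary k (powers M) ≈ t ^ (k C 2) * gaussian M k
    elementary-powers M zero = trans (elementary-zero (powers M)) (sym (*-identityˡ 1#))
    elementary-powers zero (suc k) = sym (trans (*-congˡ (gaussian-vanishes 0 (suc k) (s≤s z≤n))) (zeroʳ _))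
    elementary-powers (suc M) (suc k) = begin
      elementary (suc k) (1# ∷ xs)
        ≈⟨ elementary-∷ k 1# xs ⟩
      1# * elementary k xs + elementary (suc k) xs
        ≈⟨ +-cong (trans (*-identityˡ _) (shift k)) (shift (suc k)) ⟩
      t ^ k * (t ^ (k C 2) * gaussian M k) + t ^ suc k * (t ^ (suc k C 2) * gaussian M (suc k))
        ≈⟨ +-congʳ (*-assoc _ _ _) ⟨
      t ^ k * t ^ (k C 2) * gaussian M k + t ^ suc k * (t ^ (suc k C 2) * gaussian M (suc k))
        ≈⟨ +-cong (*-congʳ (^-homo-* t k (k C 2))) (x∙yz≈y∙xz _ _ _) ⟨
      t ^ (k ℕ.+ k C 2) * gaussian M k + t ^ (suc k C 2) * (t ^ suc k * gaussian M (suc k))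
        ≡⟨ ≡.cong (λ e → t ^ e * gaussian M k + t ^ (suc k C 2) * (t ^ suc k * gaussian M (suc k))) exponents ⟩
      t ^ (suc k C 2) * gaussian M k + t ^ (suc k C 2) * (t ^ suc k * gaussian M (suc k))
        ≈⟨ distribˡ _ _ _ ⟨
      t ^ (suc k C 2) * (gaussian M k + t ^ suc k * gaussian M (suc k))
        ≈⟨ *-congˡ (pascal M k) ⟨
      t ^ (suc k C 2) * gaussian (suc M) (suc k) ∎
      where
      xs = applyUpTo (λ i → t ^ suc i) M

      shift : ∀ k → elementary k xs ≈ t ^ k * (t ^ (k C 2) * gaussian M k)
      shift k = trans (elementary-applyUpTo-suc M k (t ^_) λ _ → refl) (*-congˡ (elementary-powers M k))

      exponents : k ℕ.+ k C 2 ≡ suc k C 2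
      exponents = ≡.trans (≡.cong (ℕ._+ k C 2) (≡.sym (nC1≡n k))) (nCk+nC[k+1]≡[n+1]C[k+1] k 1)

    -- The geometric sum Σ_{i < M} (tⁱ)ⁿ⁺¹.
    powerSum-powers : ∀ M n → (1# - (t ^ M) ^ suc n) * inv n ≈ powerSum (suc n) (powers M)
    powerSum-powers M n = begin
      (1# - (t ^ M) ^ suc n) * inv n
        ≈⟨ *-congʳ (trans (telescoped M (t ^_) (λ _ → refl)) (+-congʳ (1^n (suc n)))) ⟨
      powerSum (suc n) (powers M) * (1# - t ^ suc n) * inv n
        ≈⟨ trans (*-assoc _ _ _) (*-congˡ (inverseʳ n)) ⟩
      powerSum (suc n) (powers M) * 1#
        ≈⟨ *-identityʳ _ ⟩
      powerSum (suc n) (powers M) ∎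
      where
      1^n : ∀ n → 1# ^ n ≈ 1#
      1^n zero    = refl
      1^n (suc n) = trans (*-identityˡ _) (1^n n)

      y : Carrier
      y = t ^ suc n

      telescoped : ∀ M f → (∀ i → f (suc i) ≈ t * f i) →
                   powerSum (suc n) (applyUpTo f M) * (1# - y) ≈ f 0 ^ suc n - f M ^ suc n
      telescoped zero    f step = trans (zeroˡ _) (sym (-‿inverseʳ _))
      telescoped (suc M) f step = begin
        (f 0 ^ suc n + powerSum (suc n) (applyUpTo (λ i → f (suc i)) M)) * (1# - y)
          ≈⟨ distribʳ _ _ _ ⟩
        f 0 ^ suc n * (1# - y) + powerSum (suc n) (applyUpTo (λ i → f (suc i)) M) * (1# - y)
          ≈⟨ +-cong first (telescoped M (λ i → f (suc i)) λ i → step (suc i)) ⟩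
        (f 0 ^ suc n - f 1 ^ suc n) + (f 1 ^ suc n - f (suc M) ^ suc n)
          ≈⟨ trans (+-assoc _ _ _) (+-congˡ (sym (+-assoc _ _ _))) ⟩
        f 0 ^ suc n + (- (f 1 ^ suc n) + f 1 ^ suc n - f (suc M) ^ suc n)
          ≈⟨ +-congˡ (trans (+-congʳ (-‿inverseˡ _)) (+-identityˡ _)) ⟩
        f 0 ^ suc n - f (suc M) ^ suc n ∎
        where
        first : f 0 ^ suc n * (1# - y) ≈ f 0 ^ suc n - f 1 ^ suc n
        first = begin
          f 0 ^ suc n * (1# - y)               ≈⟨ x[y-z]≈xy-xz _ _ _ ⟩
          f 0 ^ suc n * 1# - f 0 ^ suc n * y   ≈⟨ +-cong (*-identityʳ _) (-‿cong (*-comm _ _)) ⟩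
          f 0 ^ suc n - y * f 0 ^ suc n        ≈⟨ +-congˡ (-‿cong (^-distrib-* t (f 0) (suc n))) ⟨
          f 0 ^ suc n - (t * f 0) ^ suc n      ≈⟨ +-congˡ (-‿cong (^-congˡ (suc n) (step 0))) ⟨
          f 0 ^ suc n - f 1 ^ suc n            ∎

-- The field of rational functions

open import Defs
open import Data.Product using (_×_; _,_)

private
  module P = CommutativeRing ℚ[t]
  module K = CommutativeRing ℚ⟨t⟩-ring
  open Polynomials ℚ-ring using (constant; coeff)

  constant-+ : ∀ p q → constant (p ℚ.+ q) P.≈ (constant p P.+ constant q)
  constant-+ p q zero    = ≡.refl
  constant-+ p q (suc n) = ≡.refl

  constant-* : ∀ p q → constant (p ℚ.* q) P.≈ (constant p P.* constant q)
  constant-* p q zero    = ≡.sym (ℚ.+-identityʳ (p ℚ.* q))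
  constant-* p q (suc n) = ≡.sym (PowerSeries.sum-zero ℚ-ring (suc n)
    (λ i → constant p .coeff i ℚ.* constant q .coeff (suc n ∸ i)) λ where
      zero    _ → ℚ.*-zeroʳ p
      (suc i) _ → ℚ.*-zeroˡ (constant q .coeff (n ∸ i)))

  constant-neg : ∀ p → constant (ℚ.- p) P.≈ (P.- constant p)
  constant-neg p zero    = ≡.refl
  constant-neg p (suc n) = ≡.refl

rational-isRingHomomorphism :
  IsRingHomomorphism (CommutativeRing.rawRing ℚ-ring) K.rawRing rational
rational-isRingHomomorphism = record
  { isSemiringHomomorphism = record
    { isNearSemiringHomomorphism = record
      { +-isMonoidHomomorphism = record
        { isMagmaHomomorphism = record
          { isRelHomomorphism = record { cong = λ { {p} ≡.refl → K.refl {rational p} } }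
          ; homo = λ p q → K.trans
              {rational (p ℚ.+ q)} {ℚ⟨t⟩.embed (constant p P.+ constant q)} {rational p K.+ rational q}
              (ℚ⟨t⟩.embed-cong {constant (p ℚ.+ q)} {constant p P.+ constant q} (constant-+ p q))
              (ℚ⟨t⟩.embed-+ (constant p) (constant q))
          }
        ; ε-homo = K.refl {K.0#}
        }
      ; *-homo = λ p q → K.trans
              {rational (p ℚ.* q)} {ℚ⟨t⟩.embed (constant p P.* constant q)} {rational p K.* rational q}
          (ℚ⟨t⟩.embed-cong {constant (p ℚ.* q)} {constant p P.* constant q} (constant-* p q))
          (ℚ⟨t⟩.embed-* (constant p) (constant q))
      }
    ; 1#-homo = K.refl {K.1#}
    }
  ; -‿homo = λ p → ℚ⟨t⟩.embed-cong {constant (ℚ.- p)} {P.- constant p} (constant-neg p)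
  }

private
  module N  = Mult K.semiring
  module PS = PowerSeries ℚ⟨t⟩-ring
  module FS = FormalSeries ℚ⟨t⟩-ring
  module A  = ℚ-Algebra ℚ⟨t⟩-ring rational rational-isRingHomomorphism

  1/[1-t]-inverseʳ : ∀ n → (1# - t ^ suc n) * 1/[1-t^1+ n ] ≈ 1#
  1/[1-t]-inverseʳ n = ℚ⟨t⟩.inv-inverseʳ (1# - t ^ suc n) (1-tⁿ≉0 n)

  module G = GaussianBinomials.Base ℚ⟨t⟩-ring t 1/[1-t^1+_] 1/[1-t]-inverseʳ

-- 1, t, …, t^{M-1} in ℚ(t).
powers : ℕ → List ℚ⟨t⟩
powers M = applyUpTo (t ^_) M

-- The two possible shapes of the coefficient of uⁿ⁺¹ in the exponent of F,
-- indexed by the parity of n + 1.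
data ExponentCoefficient (s : ℚ⟨t⟩) (n : ℕ) : Parity → ℚ⟨t⟩ → Set where
  even : ExponentCoefficient s n 0ℙ 0#
  odd  : ExponentCoefficient s n 1ℙ
           (rational (-[1+ 1 ] / 1)
             * ((1# - s ^ suc n) * 1/[1-t^1+ n ] * rational (+ 1 / suc n)))

exponentCoefficient : ∀ s n → ExponentCoefficient s n (parity (suc n)) (exponent s (suc n))
exponentCoefficient s n with parity (suc n)
... | 0ℙ = even
... | 1ℙ = odd

-- The exponent of F at s = t^M, so that f[ M ] consists of the coefficients of
-- exp exponent[ M ].
exponent[_] : ℕ → Series
exponent[ M ] = exponent (t ^ M)

exponent-even : ∀ M n → parity (suc n) ≡ 0ℙ → suc n N.× exponent[ M ] (suc n) ≈ 0#
exponent-even M n = multiple (exponentCoefficient (t ^ M) n)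
  where
  multiple : ∀ {p x} → ExponentCoefficient (t ^ M) n p x → p ≡ 0ℙ → suc n N.× x ≈ 0#
  multiple even _ = FS.×-zeroʳ (suc n)

exponent-odd : ∀ M n → parity (suc n) ≡ 1ℙ →
  suc n N.× exponent[ M ] (suc n)
  ≈ - (FS.powerSum (suc n) (powers M) + FS.powerSum (suc n) (powers M))
exponent-odd M n = multiple (exponentCoefficient (t ^ M) n)
  where
  multiple : ∀ {p x} → ExponentCoefficient (t ^ M) n p x → p ≡ 1ℙ →
    suc n N.× x ≈ - (FS.powerSum (suc n) (powers M) + FS.powerSum (suc n) (powers M))
  multiple odd _ = A.×-oddTerm n ((1# - (t ^ M) ^ suc n) * 1/[1-t^1+ n ])
    {FS.powerSum (suc n) (powers M)} (G.powerSum-powers M n)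

-- E(u) F(u) = E(-u).
e-⊛-f : ∀ M → e[ M ] PS.⊛ f[ M ] PS.≋ FS.reflect e[ M ]
e-⊛-f M = A.elementary-⊛-exp (powers M) exponent[ M ] e[ M ] f[ M ]
  (λ _ → ≡.refl) (λ _ → ≡.refl) (K.refl {0#}) (exponent-even M) (exponent-odd M)

e-vanishes : ∀ M k → M < k → e[ M ] k ≈ 0#
e-vanishes M k M<k = FS.elementary-vanishes k (powers M)
  (≡.subst (_< k) (≡.sym (length-applyUpTo (t ^_) M)) M<k)

proposition4p4 : (M : ℕ) → 1 ≤ M →
  (∀ j → j ≤ M → e[ M ] j ≈ t ^ (j C 2) * gaussian M j)
  × (∀ m →
      (m ≤ M → ∑[ j ≤ M ⊓ m ] (e[ M ] (toℕ j) * f[ M ] (m ∸ toℕ j)) ≈ (- 1#) ^ m * e[ M ] m)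
      × (M < m → ∑[ j ≤ M ⊓ m ] (e[ M ] (toℕ j) * f[ M ] (m ∸ toℕ j)) ≈ 0#))
  × (∀ m → M < m →
      f[ M ] m ≈ - ∑[ j < M ] (e[ M ] (suc (toℕ j)) * f[ M ] (m ∸ suc (toℕ j))))
proposition4p4 M _ =
    (λ j _ → G.elementary-powers M j)
  , (λ m → (λ _ → FS.convolution e[ M ] f[ M ] M (e-vanishes M) (e-⊛-f M) m)
         , FS.convolution-vanishes e[ M ] f[ M ] M (e-vanishes M) (e-⊛-f M) m)
  , FS.recurrence e[ M ] f[ M ] M (e-vanishes M) (e-⊛-f M) (FS.elementary-zero (powers M))
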